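{- For every integer $n\ge 1$, the square grid graph $G_n$ is similar to the disjoint union of two copies of the quartered Aztec diamond $QAD_{n-1}$ with $P_n^{(2)}$: $$G_n\sim QAD_{n-1}\ \dot{\cup}\ QAD_{n-1}\ \dot{\cup}\ P_n^{(2)}.$$
   Context: The adjacency matrix of a weighted graph has rows and columns indexed by the vertices, its $(u,v)$-entry being the weight of the edge between $u$ and $v$ if there is one, and $0$ otherwise; unweighted graphs are regarded as weighted graphs with all weights equal to $1$. Two graphs $G_1,G_2$ are called similar, written $G_1\sim G_2$, if their adjacency matrices are similar matrices. $\dot\cup$ denotes disjoint union. $G_n$ is the $n\times n$ grid graph (the subgraph of $\mathbb{Z}^2$ with nearest-neighbor edges induced by $\{1,\dots,n\}^2$). The Aztec diamond $AD_n$ is the subgraph of the grid $(\mathbb{Z}+1/2)^2$ (nearest-neighbor edges) induced by the vertices $(x,y)$ with $|x|+|y|\le n$. The quartered Aztec diamond $QAD_n$ is the subgraph of $AD_n$ induced by the vertices in its southeastern quarter ($x>0$, $y<0$); equivalently, up to isomorphism, it is the subgraph of $\mathbb{Z}^2$ induced by the points $(i,j)$ with $i,j\ge1$, $i+j\le n+1$ ($QAD_0$ is the empty graph). $P_n^{(2)}$ is the path on $n$ vertices with all edge weights equal to $2$. -}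

module Defs where

open import Algebra.Bundles using (CommutativeRing)
open import Data.Bool.Base using (if_then_else_)
open import Data.Fin.Base using (Fin; toℕ)
import Data.Fin.Properties as Fin
open import Data.Integer.Base as ℤ using (ℤ; +_; 0ℤ; 1ℤ; ∣_∣)
import Data.Integer.Properties as ℤ
open import Data.Nat.Base as ℕ using (ℕ; ∣_-_∣)
import Data.Nat.Properties as ℕ
open import Data.Product.Base using (_×_; _,_; ∃-syntax; Σ-syntax)
open import Data.Rational.Base as ℚ using (ℚ; 0ℚ; 1ℚ)
import Data.Rational.Properties as ℚ
open import Data.Refinement.Base using (Refinement; value)
open import Data.Sum.Base using (_⊎_; inj₁; inj₂)
open import Data.Sum.Relation.Binary.Pointwise as Pointwise using (Pointwise)
open import Function.Base using (_on_)
open import Function.Bundles using (_↔_; Inverse)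
open import Relation.Binary.Core using (Rel)
open import Relation.Binary.Definitions using (Decidable; Symmetric)
open import Relation.Binary.PropositionalEquality
  using (_≡_; refl; sym; trans; cong₂)
open import Relation.Nullary.Decidable.Core using (yes; no; does)
open import Relation.Nullary.Negation.Core using (¬_)
open import Relation.Unary using (Pred)
open import Level using (0ℓ)

open import Algebra.Properties.CommutativeMonoid.Sum
  (CommutativeRing.+-commutativeMonoid ℚ.+-*-commutativeRing) using (sum)

------------------------------------------------------------------------
-- Square matrices over ℚ

Matrix : ℕ → Set
Matrix n = Fin n → Fin n → ℚ

infix  4 _≈ₘ_
infixl 7 _*ₘ_

_≈ₘ_ : ∀ {n} → Matrix n → Matrix n → Set
A ≈ₘ B = ∀ i j → A i j ≡ B i j

_*ₘ_ : ∀ {n} → Matrix n → Matrix n → Matrix n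
(A *ₘ B) i j = sum λ k → A i k ℚ.* B k j

1ₘ : ∀ {n} → Matrix n
1ₘ i j = if does (i Fin.≟ j) then 1ℚ else 0ℚ

-- For rational matrices, similarity over ℚ, over ℝ and over ℂ coincide.
Similar : ∀ {n} → Matrix n → Matrix n → Set
Similar {n} A B =
  Σ[ P ∈ Matrix n ] Σ[ P⁻¹ ∈ Matrix n ]
    (P *ₘ P⁻¹ ≈ₘ 1ₘ) × (P⁻¹ *ₘ P ≈ₘ 1ₘ) × (A ≈ₘ P *ₘ B *ₘ P⁻¹)

------------------------------------------------------------------------
-- Simple graphs and weighted graphs

-- The vertex set may be infinite, so that lattices are graphs as well.
record Graph : Set₁ where
  field
    Vertex     : Set
    Adj        : Rel Vertex 0ℓ
    adj?       : Decidable Adj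
    adj-sym    : Symmetric Adj
    adj-irrefl : ∀ {v} → ¬ Adj v v

record WeightedGraph : Set₁ where
  field
    graph : Graph
  open Graph graph public
  field
    weight     : ∀ u v → .(Adj u v) → ℚ
    weight-sym : ∀ u v .(e : Adj u v) → weight u v e ≡ weight v u (adj-sym e)

induced : (G : Graph) → Pred (Graph.Vertex G) 0ℓ → Graph
induced G S = record
  { Vertex     = Refinement Vertex S
  ; Adj        = Adj on value
  ; adj?       = λ u v → adj? (value u) (value v)
  ; adj-sym    = adj-sym
  ; adj-irrefl = adj-irrefl
  }
  where open Graph G

constantWeight : ℚ → Graph → WeightedGraph
constantWeight q G = record
  { graph      = G
  ; weight     = λ _ _ _ → q
  ; weight-sym = λ _ _ _ → refl
  }

unweighted : Graph → WeightedGraph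
unweighted = constantWeight 1ℚ

infixr 6 _∪̇_

_∪̇_ : WeightedGraph → WeightedGraph → WeightedGraph
G ∪̇ H = record
  { graph = record
    { Vertex     = G.Vertex ⊎ H.Vertex
    ; Adj        = Pointwise G.Adj H.Adj
    ; adj?       = Pointwise.⊎-decidable G.adj? H.adj?
    ; adj-sym    = Pointwise.⊎-symmetric G.adj-sym H.adj-sym
    ; adj-irrefl = λ {v} → irrefl v
    }
  ; weight     = weight
  ; weight-sym = weight-sym
  }
  where
  module G = WeightedGraph G
  module H = WeightedGraph H

  irrefl : ∀ v → ¬ Pointwise G.Adj H.Adj v v
  irrefl (inj₁ _) e = G.adj-irrefl (Pointwise.drop-inj₁ e)
  irrefl (inj₂ _) e = H.adj-irrefl (Pointwise.drop-inj₂ e)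

  weight : ∀ u v → .(Pointwise G.Adj H.Adj u v) → ℚ
  weight (inj₁ u) (inj₁ v) e = G.weight u v (Pointwise.drop-inj₁ e)
  weight (inj₂ u) (inj₂ v) e = H.weight u v (Pointwise.drop-inj₂ e)
  weight (inj₁ _) (inj₂ _) ()
  weight (inj₂ _) (inj₁ _) ()

  weight-sym : ∀ u v .(e : Pointwise G.Adj H.Adj u v) →
               weight u v e ≡ weight v u (Pointwise.⊎-symmetric G.adj-sym H.adj-sym e)
  weight-sym (inj₁ u) (inj₁ v) e = G.weight-sym u v (Pointwise.drop-inj₁ e)
  weight-sym (inj₂ u) (inj₂ v) e = H.weight-sym u v (Pointwise.drop-inj₂ e)
  weight-sym (inj₁ _) (inj₂ _) ()
  weight-sym (inj₂ _) (inj₁ _) ()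

------------------------------------------------------------------------
-- Adjacency matrices and similarity of graphs

adjacencyEntry : (G : WeightedGraph) (u v : WeightedGraph.Vertex G) → ℚ
adjacencyEntry G u v with WeightedGraph.adj? G u v
... | yes e = WeightedGraph.weight G u v e
... | no  _ = 0ℚ

adjacencyMatrix : (G : WeightedGraph) {n : ℕ} →
                  Fin n ↔ WeightedGraph.Vertex G → Matrix n
adjacencyMatrix G e i j = adjacencyEntry G (Inverse.to e i) (Inverse.to e j)

infix 4 _∼_

-- Reordering the vertices conjugates the adjacency matrix by a permutation
-- matrix, so the choice of orderings is immaterial.  In particular both
-- graphs are finite, with equally many vertices.
_∼_ : WeightedGraph → WeightedGraph → Set
G ∼ H = ∃[ n ] Σ[ e ∈ Fin n ↔ WeightedGraph.Vertex G ]
               Σ[ f ∈ Fin n ↔ WeightedGraph.Vertex H ]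
               Similar (adjacencyMatrix G e) (adjacencyMatrix H f)

------------------------------------------------------------------------
-- The graphs in question

1≢0 : ¬ 0 ≡ 1
1≢0 ()

-- Nearest neighbours are the points at ℓ¹-distance 1.
lattice : Graph
lattice = record
  { Vertex     = ℤ × ℤ
  ; Adj        = λ u v → dist u v ≡ 1
  ; adj?       = λ u v → dist u v ℕ.≟ 1
  ; adj-sym    = λ {u} {v} → trans (dist-sym v u)
  ; adj-irrefl = λ {v} e → 1≢0 (trans (sym (dist-refl v)) e)
  }
  where
  dist : ℤ × ℤ → ℤ × ℤ → ℕ
  dist (a , b) (c , d) = ∣ a ℤ.- c ∣ ℕ.+ ∣ b ℤ.- d ∣

  dist-sym : ∀ u v → dist u v ≡ dist v u
  dist-sym (a , b) (c , d) = cong₂ ℕ._+_ (ℤ.∣i-j∣≡∣j-i∣ a c) (ℤ.∣i-j∣≡∣j-i∣ b d)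

  dist-refl : ∀ v → dist v v ≡ 0
  dist-refl (a , b) =
    cong₂ (λ x y → ∣ x ∣ ℕ.+ ∣ y ∣) (ℤ.+-inverseʳ a) (ℤ.+-inverseʳ b)

grid : ℕ → Graph
grid n = induced lattice inSquare
  where
  inSquare : ℤ × ℤ → Set
  inSquare (a , b) = (1ℤ ℤ.≤ a × a ℤ.≤ + n) × (1ℤ ℤ.≤ b × b ℤ.≤ + n)

-- The grid (ℤ + 1/2)² is represented by `lattice`: the pair (a , b) stands for
-- the point (x , y) = (a + 1/2 , b + 1/2).  `twice a` is the integer 2x, so
-- |x| + |y| ≤ n, x > 0 and y < 0 are expressed after multiplication by 2.
twice : ℤ → ℤ
twice a = + 2 ℤ.* a ℤ.+ 1ℤ

AD : ℕ → Graph
AD n = induced lattice inDiamond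
  where
  inDiamond : ℤ × ℤ → Set
  inDiamond (a , b) = ∣ twice a ∣ ℕ.+ ∣ twice b ∣ ℕ.≤ 2 ℕ.* n

QAD : ℕ → Graph
QAD n = induced (AD n) λ v → southeast (value v)
  where
  southeast : ℤ × ℤ → Set
  southeast (a , b) = 0ℤ ℤ.< twice a × twice b ℤ.< 0ℤ

path : ℕ → Graph
path n = record
  { Vertex     = Fin n
  ; Adj        = λ i j → ∣ toℕ i - toℕ j ∣ ≡ 1
  ; adj?       = λ i j → ∣ toℕ i - toℕ j ∣ ℕ.≟ 1
  ; adj-sym    = λ {i} {j} → trans (ℕ.∣-∣-comm (toℕ j) (toℕ i))
  ; adj-irrefl = λ {i} e → 1≢0 (trans (sym (ℕ.∣n-n∣≡0 (toℕ i))) e)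
  }

P⁽²⁾ : ℕ → WeightedGraph
P⁽²⁾ n = constantWeight (1ℚ ℚ.+ 1ℚ) (path n)

{-# OPTIONS --safe #-}
module Submission where

-- Regard functions on the n × n grid as matrices X.  With P the adjacency
-- matrix of the path, the grid acts by 𝒜 X = P X + X P, which commutes with
-- 𝒟 X = P X − X P and with transposition.  On antisymmetric matrices, i.e.
-- functions on the strict upper triangle, 𝒜 is the adjacency operator of the
-- quartered Aztec diamond, because no edge crosses the diagonal.  The map 𝒟
-- embeds a second copy of the antisymmetric matrices into the symmetric ones.
-- Its kernel consists of the polynomials in P, on which 𝒜 is multiplication
-- by 2 P: this is the path with weights 2.  The parts intersect trivially since
-- 𝒟 is self-adjoint, so that 𝒟² X = 0 implies 𝒟 X = 0, and since polynomials
-- in P are symmetric.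

open import Defs
open import Data.Nat using (ℕ; _≤_; _∸_)
open import Algebra.Bundles using (CommutativeRing)
import Algebra.Properties.Group as GroupProperties
open import Data.Empty using (⊥; ⊥-elim-irr)
open import Data.Fin.Base using (Fin; zero; suc; toℕ; fromℕ<; opposite; punchIn; punchOut; splitAt; quotRem; remQuot)
import Data.Fin.Properties as Fin
open import Data.Integer.Base as ℤ using (ℤ; -[1+_]; 0ℤ; 1ℤ; _⊖_)
import Data.Integer.Properties as ℤ
open import Data.Irrelevant using ([_])
open import Data.Nat.Base as ℕ using (zero; suc; _<_; z≤n; s≤s; ∣_-_∣)
import Data.Nat.Properties as ℕ
open import Data.Nat.Solver using () renaming (module +-*-Solver to ℕ-Solver)
open import Data.Product.Base using (_×_; _,_; proj₁; proj₂; Σ-syntax; ∃-syntax; swap; map₂)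
open import Data.Rational.Base as ℚ
  using (ℚ; 0ℚ; 1ℚ; ½; _+_; _*_; -_; _-_; 1/_; ≢-nonZero; NonNegative; nonNegative)
import Data.Rational.Properties as ℚ
open import Data.Rational.Solver using (module +-*-Solver)
open import Data.Refinement.Base using (_,_)
open import Data.Refinement.Properties using (value-injective)
open import Data.Sum.Base using (_⊎_; inj₁; inj₂; [_,_]′; map₁)
open import Data.Sum.Function.Propositional using (_⊎-↔_)
import Data.Sum.Relation.Binary.Pointwise as Pointwise
open import Data.Vec.Functional using (_∷_)
open import Function.Base using (_∘_; _$_)
open import Function.Bundles using (_↔_; Inverse; mk↔ₛ′)
open import Function.Construct.Composition using (_↔-∘_)
open import Function.Construct.Identity using (↔-id)
open import Relation.Binary.PropositionalEquality
open import Relation.Nullary.Decidable.Core using (Dec; yes; no; ¬?; decidable-stable)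
open import Relation.Nullary.Negation.Core using (¬_; contradiction)

open import Algebra.Properties.Semiring.Sum (CommutativeRing.semiring ℚ.+-*-commutativeRing)
  using (sum; sum-cong-≗; ∑-distrib-+; ∑-comm; sum-replicate-zero; *-distribˡ-sum; *-distribʳ-sum)
open GroupProperties ℚ.+-0-group using (x∙y⁻¹≈ε⇒x≈y)

open WeightedGraph using (Adj; weight)
open Inverse using (to; from; strictlyInverseˡ; strictlyInverseʳ)
open +-*-Solver using (solve; _:=_; _:+_; _:*_; :-_; _:-_; con)
open ≡-Reasoning

-- Linear algebra over ℚ

-- The eigenvalues of the grid are the sums 2 cos(iπ/(n+1)) + 2 cos(jπ/(n+1)): those with i = j
-- belong to the weighted path, and the others come in pairs (i, j), (j, i). The eigenvectors are
-- irrational in general, so the proof builds one rational intertwiner from the three summands to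
-- the grid instead. Its injectivity is enough, because n(n-1)/2 + n(n-1)/2 + n = n² and a square
-- matrix over ℚ with trivial kernel is invertible. Transposition exchanges left and right
-- multiplication by P, which is why 𝒟 makes antisymmetric matrices symmetric. On these 𝒟 is
-- injective: an antisymmetric X commuting with P is a polynomial in P, hence symmetric, hence 0.
-- That the commutant of P consists of polynomials comes from the cyclic vector e₁: the Chebyshev
-- polynomials `U k` of P send e₁ to e_k, so a first row determines a commuting matrix, and every
-- first row occurs. Positivity of sums of squares in ℚ replaces a diagonalisation of 𝒟.

sum-zero : ∀ {n} {f : Fin n → ℚ} → (∀ i → f i ≡ 0ℚ) → sum f ≡ 0ℚ
sum-zero {n} f≡0 = trans (sum-cong-≗ f≡0) (sum-replicate-zero n)

sum-linear : ∀ {n} (c d : ℚ) (f g : Fin n → ℚ) →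
             sum (λ i → c * f i + d * g i) ≡ c * sum f + d * sum g
sum-linear c d f g = trans (∑-distrib-+ (λ i → c * f i) (λ i → d * g i))
  (sym (cong₂ _+_ (*-distribˡ-sum c f) (*-distribˡ-sum d g)))

sum-δ : ∀ {n} (f : Fin n → ℚ) j → sum (λ i → f i * 1ₘ i j) ≡ f j
sum-δ f zero = begin
  f zero * 1ℚ + sum (λ i → f (suc i) * 0ℚ)
    ≡⟨ cong₂ _+_ (ℚ.*-identityʳ (f zero)) (sum-zero (λ i → ℚ.*-zeroʳ (f (suc i)))) ⟩
  f zero + 0ℚ
    ≡⟨ ℚ.+-identityʳ (f zero) ⟩
  f zero ∎
sum-δ f (suc j) = begin
  f zero * 0ℚ + sum (λ i → f (suc i) * 1ₘ i j)
    ≡⟨ cong₂ _+_ (ℚ.*-zeroʳ (f zero)) (sum-δ (f ∘ suc) j) ⟩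
  0ℚ + f (suc j)
    ≡⟨ ℚ.+-identityˡ (f (suc j)) ⟩
  f (suc j) ∎

infixr 8 _·_

_·_ : ∀ {n} → Matrix n → (Fin n → ℚ) → (Fin n → ℚ)
(A · x) i = sum λ k → A i k * x k

·-cong : ∀ {n} (A : Matrix n) {x y : Fin n → ℚ} → x ≗ y → A · x ≗ A · y
·-cong A x≗y i = sum-cong-≗ λ k → cong (A i k *_) (x≗y k)

·-assoc : ∀ {n} (A B : Matrix n) x → (A *ₘ B) · x ≗ A · (B · x)
·-assoc {n} A B x i = begin
  sum (λ k → sum (λ l → A i l * B l k) * x k)
    ≡⟨ sum-cong-≗ {n} (λ k → *-distribʳ-sum (x k) (λ l → A i l * B l k)) ⟩
  sum (λ k → sum (λ l → A i l * B l k * x k))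
    ≡⟨ ∑-comm (λ k l → A i l * B l k * x k) ⟩
  sum (λ l → sum (λ k → A i l * B l k * x k))
    ≡⟨ sum-cong-≗ {n} (λ l → sum-cong-≗ {n} λ k → ℚ.*-assoc (A i l) (B l k) (x k)) ⟩
  sum (λ l → sum (λ k → A i l * (B l k * x k)))
    ≡⟨ sum-cong-≗ {n} (λ l → *-distribˡ-sum (A i l) (λ k → B l k * x k)) ⟨
  sum (λ l → A i l * sum (λ k → B l k * x k)) ∎

1·x≗x : ∀ {n} (x : Fin n → ℚ) → 1ₘ · x ≗ x
1·x≗x x zero =
  trans (cong₂ _+_ (ℚ.*-identityˡ (x zero)) (sum-zero λ i → ℚ.*-zeroˡ (x (suc i)))) (ℚ.+-identityʳ (x zero))
1·x≗x x (suc i) =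
  trans (cong₂ _+_ (ℚ.*-zeroˡ (x zero)) (1·x≗x (x ∘ suc) i)) (ℚ.+-identityˡ (x (suc i)))

TrivialKernel : ∀ {n} → Matrix n → Set
TrivialKernel A = ∀ x → (∀ i → (A · x) i ≡ 0ℚ) → ∀ i → x i ≡ 0ℚ

-- One step of Gaussian elimination with pivot row `r` in the first column. `S` is the Schur
-- complement of the pivot, and `lift t y` chooses the eliminated first unknown so that equation `r`
-- has value `t`.
module Elimination {n} (A : Matrix (suc n)) (r : Fin (suc n)) (A≢0 : A r zero ≢ 0ℚ) where

  instance
    pivot≢0 = ≢-nonZero A≢0

  c : ℚ
  c = 1/ A r zero

  S : Matrix n
  S i j = A (punchIn r i) (suc j) - A (punchIn r i) zero * (c * A r (suc j))

  rest : (Fin n → ℚ) → Fin (suc n) → ℚ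
  rest y i = sum λ j → A i (suc j) * y j

  lift : ℚ → (Fin n → ℚ) → Fin (suc n) → ℚ
  lift t y = c * (t - rest y r) ∷ y

  lift-pivot : ∀ t y → (A · lift t y) r ≡ t
  lift-pivot t y = begin
    A r zero * (c * (t - rest y r)) + rest y r
      ≡⟨ solve 4 (λ b c t s → b :* (c :* (t :- s)) :+ s := b :* c :* (t :- s) :+ s) refl (A r zero) c t (rest y r) ⟩
    A r zero * c * (t - rest y r) + rest y r
      ≡⟨ cong (λ u → u * (t - rest y r) + rest y r) (ℚ.*-inverseʳ (A r zero)) ⟩
    1ℚ * (t - rest y r) + rest y r
      ≡⟨ solve 2 (λ t s → con 1ℚ :* (t :- s) :+ s := t) refl t (rest y r) ⟩
    t ∎

  S·y : ∀ y i → (S · y) i ≡ rest y (punchIn r i) - A (punchIn r i) zero * (c * rest y r)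
  S·y y i = begin
    sum (λ j → (A i′ (suc j) - a * (c * A r (suc j))) * y j)
      ≡⟨ sum-cong-≗ (λ j → solve 5 (λ u a c v y → (u :- a :* (c :* v)) :* y := con 1ℚ :* (u :* y) :+ (:- (a :* c)) :* (v :* y)) refl
           (A i′ (suc j)) a c (A r (suc j)) (y j)) ⟩
    sum (λ j → 1ℚ * (A i′ (suc j) * y j) + (- (a * c)) * (A r (suc j) * y j))
      ≡⟨ sum-linear 1ℚ (- (a * c)) (λ j → A i′ (suc j) * y j) (λ j → A r (suc j) * y j) ⟩
    1ℚ * rest y i′ + (- (a * c)) * rest y r
      ≡⟨ solve 4 (λ s a c t → con 1ℚ :* s :+ (:- (a :* c)) :* t := s :- a :* (c :* t)) refl (rest y i′) a c (rest y r) ⟩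
    rest y i′ - a * (c * rest y r) ∎
    where
    i′ = punchIn r i
    a  = A i′ zero

  lift-other : ∀ t y i → (A · lift t y) (punchIn r i) ≡ (S · y) i + A (punchIn r i) zero * (c * t)
  lift-other t y i = begin
    a * (c * (t - rest y r)) + rest y i′
      ≡⟨ solve 5 (λ a c t s u → a :* (c :* (t :- s)) :+ u := u :- a :* (c :* s) :+ a :* (c :* t)) refl
           a c t (rest y r) (rest y i′) ⟩
    rest y i′ - a * (c * rest y r) + a * (c * t)
      ≡⟨ cong (_+ a * (c * t)) (S·y y i) ⟨
    (S · y) i + a * (c * t) ∎
    where
    i′ = punchIn r i
    a  = A i′ zero

  lift-solves : ∀ z y → (∀ i → (S · y) i ≡ z (punchIn r i) - A (punchIn r i) zero * (c * z r)) →
                A · lift (z r) y ≗ z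
  lift-solves z y eq i with r Fin.≟ i
  ... | yes refl = lift-pivot (z r) y
  ... | no r≢i = subst (λ k → (A · lift (z r) y) k ≡ z k) (Fin.punchIn-punchOut r≢i) $ begin
    (A · lift (z r) y) i′       ≡⟨ lift-other (z r) y (punchOut r≢i) ⟩
    (S · y) (punchOut r≢i) + d  ≡⟨ cong (_+ d) (eq (punchOut r≢i)) ⟩
    z i′ - d + d                ≡⟨ solve 2 (λ u d → u :- d :+ d := u) refl (z i′) d ⟩
    z i′ ∎
    where
    i′ = punchIn r (punchOut r≢i)
    d  = A i′ zero * (c * z r)

  -- Lifting with `t` equal to 0 turns a kernel vector of `S` into a kernel vector of `A` with the
  -- same tail.
  S-trivialKernel : TrivialKernel A → TrivialKernel S
  S-trivialKernel inj y Sy≡0 = inj (lift 0ℚ y) (lift-solves (λ _ → 0ℚ) y λ i → trans (Sy≡0 i) $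
    solve 2 (λ a c → con 0ℚ := con 0ℚ :- a :* (c :* con 0ℚ)) refl (A (punchIn r i) zero) c) ∘ suc

1≢0ℚ : 1ℚ ≢ 0ℚ
1≢0ℚ ()

trivialKernel⇒surjective : ∀ {n} (A : Matrix n) → TrivialKernel A → ∀ z → ∃[ x ] A · x ≗ z
trivialKernel⇒surjective {zero}  A inj z = (λ ()) , λ ()
trivialKernel⇒surjective {suc n} A inj z with Fin.any? (λ r → ¬? (A r zero ℚ.≟ 0ℚ))
-- If the first column vanishes, the first standard basis vector lies in the kernel.
... | no ¬pivot = contradiction (inj (1ℚ ∷ λ _ → 0ℚ) Ae≡0 zero) 1≢0ℚ
  where
  Ae≡0 : ∀ i → A i zero * 1ℚ + sum (λ k → A i (suc k) * 0ℚ) ≡ 0ℚ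
  Ae≡0 i = cong₂ _+_ (trans (ℚ.*-identityʳ _) (decidable-stable (A i zero ℚ.≟ 0ℚ) λ A≢0 → ¬pivot (i , A≢0)))
                     (sum-zero λ k → ℚ.*-zeroʳ (A i (suc k)))
... | yes (r , A≢0) = lift (z r) (proj₁ y) , lift-solves z (proj₁ y) (proj₂ y)
  where
  open Elimination A r A≢0
  y = trivialKernel⇒surjective S (S-trivialKernel inj) (λ i → z (punchIn r i) - A (punchIn r i) zero * (c * z r))

1ₘ-action : ∀ {n} {A : Matrix n} → A ≈ₘ 1ₘ → ∀ x → A · x ≗ x
1ₘ-action A≈1 x i = trans (sum-cong-≗ λ k → cong (_* x k) (A≈1 i k)) (1·x≗x x i)

rightInverse : ∀ {n} (A : Matrix n) → TrivialKernel A → ∃[ B ] A *ₘ B ≈ₘ 1ₘ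
rightInverse A inj = (λ i j → proj₁ (column j) i) , λ i j → proj₂ (column j) i
  where
  column : ∀ j → ∃[ x ] A · x ≗ (λ i → 1ₘ i j)
  column j = trivialKernel⇒surjective A inj (λ i → 1ₘ i j)

-- A right inverse B has itself a right inverse C, and then C = A B C = A.
inverse : ∀ {n} (A : Matrix n) → TrivialKernel A → ∃[ B ] A *ₘ B ≈ₘ 1ₘ × B *ₘ A ≈ₘ 1ₘ
inverse A inj with B , AB≈1 ← rightInverse A inj = B , AB≈1 , BA≈1
  where
  AB·x≗x : ∀ x → A · (B · x) ≗ x
  AB·x≗x x i = trans (sym (·-assoc A B x i)) (1ₘ-action AB≈1 x i)

  B-inj : TrivialKernel B
  B-inj x Bx≡0 i = trans (sym (AB·x≗x x i))
    (sum-zero λ k → trans (cong (A i k *_) (Bx≡0 k)) (ℚ.*-zeroʳ (A i k)))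

  C : Matrix _
  C = proj₁ (rightInverse B B-inj)

  BC·x≗x : ∀ x → B · (C · x) ≗ x
  BC·x≗x x i = trans (sym (·-assoc B C x i)) (1ₘ-action (proj₂ (rightInverse B B-inj)) x i)

  BA·x≗x : ∀ x → B · (A · x) ≗ x
  BA·x≗x x i = begin
    (B · (A · x)) i              ≡⟨ ·-cong B (·-cong A (BC·x≗x x)) i ⟨
    (B · (A · (B · (C · x)))) i  ≡⟨ ·-cong B (AB·x≗x (C · x)) i ⟩
    (B · (C · x)) i              ≡⟨ BC·x≗x x i ⟩
    x i                          ∎

  BA≈1 : B *ₘ A ≈ₘ 1ₘ
  BA≈1 i j = trans (·-cong B (λ k → sym (sum-δ (A k) j)) i) (BA·x≗x (λ l → 1ₘ l j) i)

-- Linear functionals, and similarity from an injective intertwiner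

record Linear {I : Set} (φ : (I → ℚ) → ℚ) : Set where
  field
    -- Without function extensionality, invariance under pointwise equality has to be demanded
    -- separately.
    cong-≗ : ∀ {f g} → f ≗ g → φ f ≡ φ g
    homo-+ : ∀ f g → φ (λ i → f i + g i) ≡ φ f + φ g
    homo-* : ∀ c f → φ (λ i → c * f i) ≡ c * φ f

  homo-0 : φ (λ _ → 0ℚ) ≡ 0ℚ
  homo-0 = begin
    φ (λ _ → 0ℚ)         ≡⟨ cong-≗ (λ _ → ℚ.*-zeroˡ 0ℚ) ⟨
    φ (λ _ → 0ℚ * 0ℚ)    ≡⟨ homo-* 0ℚ (λ _ → 0ℚ) ⟩
    0ℚ * φ (λ _ → 0ℚ)    ≡⟨ ℚ.*-zeroˡ (φ λ _ → 0ℚ) ⟩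
    0ℚ                   ∎

  homo-sum : ∀ {n} (f : Fin n → I → ℚ) → φ (λ i → sum λ k → f k i) ≡ sum λ k → φ (f k)
  homo-sum {zero}  f = homo-0
  homo-sum {suc n} f = trans (homo-+ (f zero) _) (cong (φ (f zero) +_) (homo-sum (f ∘ suc)))

module _ {I : Set} where

  eval-linear : ∀ i → Linear {I} (λ f → f i)
  eval-linear i = record { cong-≗ = λ f≗g → f≗g i ; homo-+ = λ _ _ → refl ; homo-* = λ _ _ → refl }

  zero-linear : Linear {I} (λ _ → 0ℚ)
  zero-linear = record
    { cong-≗ = λ _ → refl ; homo-+ = λ _ _ → sym (ℚ.+-identityʳ 0ℚ) ; homo-* = λ c _ → sym (ℚ.*-zeroʳ c) }

  module _ {φ ψ : (I → ℚ) → ℚ} (L : Linear φ) (M : Linear ψ) where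
    private
      module L = Linear L
      module M = Linear M

    combination-linear : ∀ a b → Linear (λ f → a * φ f + b * ψ f)
    combination-linear a b = record
      { cong-≗ = λ f≗g → cong₂ (λ u v → a * u + b * v) (L.cong-≗ f≗g) (M.cong-≗ f≗g)
      ; homo-+ = λ f g → trans (cong₂ (λ u v → a * u + b * v) (L.homo-+ f g) (M.homo-+ f g))
          (solve 6 (λ a b u u′ v v′ → a :* (u :+ u′) :+ b :* (v :+ v′) := (a :* u :+ b :* v) :+ (a :* u′ :+ b :* v′))
            refl a b (φ f) (φ g) (ψ f) (ψ g))
      ; homo-* = λ c f → trans (cong₂ (λ u v → a * u + b * v) (L.homo-* c f) (M.homo-* c f))
          (solve 5 (λ a b c u v → a :* (c :* u) :+ b :* (c :* v) := c :* (a :* u :+ b :* v)) refl a b c (φ f) (ψ f))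
      }

  Linear-resp-≗ : ∀ {φ ψ : (I → ℚ) → ℚ} → φ ≗ ψ → Linear φ → Linear ψ
  Linear-resp-≗ {φ} {ψ} φ≗ψ L = record
    { cong-≗ = λ {f} {g} f≗g → trans (sym (φ≗ψ f)) (trans (cong-≗ f≗g) (φ≗ψ g))
    ; homo-+ = λ f g → trans (sym (φ≗ψ _)) (trans (homo-+ f g) (cong₂ _+_ (φ≗ψ f) (φ≗ψ g)))
    ; homo-* = λ c f → trans (sym (φ≗ψ _)) (trans (homo-* c f) (cong (c *_) (φ≗ψ f)))
    }
    where open Linear L

  module _ {φ ψ : (I → ℚ) → ℚ} (L : Linear φ) (M : Linear ψ) where

    +-linear : Linear (λ f → φ f + ψ f)
    +-linear = Linear-resp-≗ (λ f → cong₂ _+_ (ℚ.*-identityˡ (φ f)) (ℚ.*-identityˡ (ψ f))) (combination-linear L M 1ℚ 1ℚ)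

    minus-linear : Linear (λ f → φ f - ψ f)
    minus-linear = Linear-resp-≗
      (λ f → solve 2 (λ u v → con 1ℚ :* u :+ (:- con 1ℚ) :* v := u :- v) refl (φ f) (ψ f)) (combination-linear L M 1ℚ (- 1ℚ))

  *-linear : ∀ {φ : (I → ℚ) → ℚ} c → Linear φ → Linear (λ f → c * φ f)
  *-linear {φ} c L = Linear-resp-≗
    (λ f → trans (cong (c * φ f +_) (ℚ.*-zeroˡ 0ℚ)) (ℚ.+-identityʳ _)) (combination-linear L zero-linear c 0ℚ)

  sum-functionals : ∀ {n} {φ : Fin n → (I → ℚ) → ℚ} → (∀ k → Linear (φ k)) → Linear (λ f → sum λ k → φ k f)
  sum-functionals {zero}  L = zero-linear
  sum-functionals {suc n} L = +-linear (L zero) (sum-functionals (L ∘ suc))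

precompose-linear : ∀ {I J : Set} {φ : (I → ℚ) → ℚ} (h : I → J) → Linear φ → Linear (λ f → φ (f ∘ h))
precompose-linear h L = record
  { cong-≗ = λ f≗g → cong-≗ (f≗g ∘ h) ; homo-+ = λ f g → homo-+ (f ∘ h) (g ∘ h) ; homo-* = λ c f → homo-* c (f ∘ h) }
  where open Linear L

linear-sub : ∀ {I : Set} {φ : (I → ℚ) → ℚ} → Linear φ → ∀ f g → φ (λ i → f i - g i) ≡ φ f - φ g
linear-sub {φ = φ} L f g = begin
  φ (λ i → f i - g i)              ≡⟨ cong-≗ (λ i → cong (f i +_) (-1* (g i))) ⟩
  φ (λ i → f i + (- 1ℚ) * g i)     ≡⟨ homo-+ f (λ i → (- 1ℚ) * g i) ⟩
  φ f + φ (λ i → (- 1ℚ) * g i)     ≡⟨ cong (φ f +_) (homo-* (- 1ℚ) g) ⟩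
  φ f + (- 1ℚ) * φ g               ≡⟨ cong (φ f +_) (-1* (φ g)) ⟨
  φ f - φ g                        ∎
  where
  open Linear L
  -1* : ∀ x → - x ≡ (- 1ℚ) * x
  -1* = solve 1 (λ x → :- x := (:- con 1ℚ) :* x) refl

-- The matrix `P` whose columns are the images under `T` of the standard basis is invertible, and
-- the intertwining relation becomes A P = P B.
intertwiner⇒similar : ∀ {n} {A B : Matrix n} (T : (Fin n → ℚ) → Fin n → ℚ) →
  (∀ i → Linear (λ x → T x i)) →
  (∀ x → (∀ i → T x i ≡ 0ℚ) → ∀ i → x i ≡ 0ℚ) →
  (∀ x → A · T x ≗ T (B · x)) →
  Similar A B
intertwiner⇒similar {n} {A} {B} T T-linear T-inj AT≗TB =
  P , P⁻¹ , PP⁻¹≈1 , proj₂ (proj₂ (inverse P P-inj)) , A≈PBP⁻¹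
  where
  module T i = Linear (T-linear i)

  P : Matrix n
  P i j = T (λ k → 1ₘ k j) i

  P·x≗Tx : ∀ x → P · x ≗ T x
  P·x≗Tx x i = begin
    sum (λ j → T (λ k → 1ₘ k j) i * x j)      ≡⟨ sum-cong-≗ (λ j → ℚ.*-comm (P i j) (x j)) ⟩
    sum (λ j → x j * T (λ k → 1ₘ k j) i)      ≡⟨ sum-cong-≗ (λ j → T.homo-* i (x j) (λ k → 1ₘ k j)) ⟨
    sum (λ j → T (λ k → x j * 1ₘ k j) i)      ≡⟨ T.homo-sum i (λ j k → x j * 1ₘ k j) ⟨
    T (λ k → sum λ j → x j * 1ₘ k j) i        ≡⟨ T.cong-≗ i (λ k → trans (sum-cong-≗ λ j → ℚ.*-comm (x j) (1ₘ k j)) (1·x≗x x k)) ⟩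
    T x i                                     ∎

  P-inj : TrivialKernel P
  P-inj x Px≡0 = T-inj x λ i → trans (sym (P·x≗Tx x i)) (Px≡0 i)

  P⁻¹ : Matrix n
  P⁻¹ = proj₁ (inverse P P-inj)

  PP⁻¹≈1 : P *ₘ P⁻¹ ≈ₘ 1ₘ
  PP⁻¹≈1 = proj₁ (proj₂ (inverse P P-inj))

  AP≈PB : A *ₘ P ≈ₘ P *ₘ B
  AP≈PB i j = trans (AT≗TB (λ k → 1ₘ k j) i)
    (trans (T.cong-≗ i (λ k → sum-δ (B k) j)) (sym (P·x≗Tx (λ k → B k j) i)))

  A≈PBP⁻¹ : A ≈ₘ P *ₘ B *ₘ P⁻¹
  A≈PBP⁻¹ i j = begin
    A i j                               ≡⟨ sum-δ (A i) j ⟨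
    sum (λ k → A i k * 1ₘ k j)          ≡⟨ sum-cong-≗ (λ k → cong (A i k *_) (PP⁻¹≈1 k j)) ⟨
    (A · (P · λ k → P⁻¹ k j)) i         ≡⟨ ·-assoc A P (λ k → P⁻¹ k j) i ⟨
    ((A *ₘ P) · λ k → P⁻¹ k j) i        ≡⟨ sum-cong-≗ (λ k → cong (_* P⁻¹ k j) (AP≈PB i k)) ⟩
    (P *ₘ B *ₘ P⁻¹) i j                 ∎

-- The path

-- Indicators of a distance, given by recursion so that sums over `Fin (suc n)` reduce by
-- computation when both indices are successors.
is0 : ℕ → ℚ
is0 zero    = 1ℚ
is0 (suc _) = 0ℚ

is1 : ℕ → ℚ
is1 zero    = 0ℚ
is1 (suc d) = is0 d

distance : ∀ {n} → Fin n → Fin n → ℕ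
distance i j = ∣ toℕ i - toℕ j ∣

𝒫 : ∀ {n} → (Fin n → ℚ) → Fin n → ℚ
𝒫 f i = sum λ k → is1 (distance i k) * f k

sum-is0 : ∀ {n} (f : Fin n → ℚ) i → sum (λ k → is0 (distance i k) * f k) ≡ f i
sum-is0 {suc n} f zero = begin
  1ℚ * f zero + sum (λ k → 0ℚ * f (suc k))
    ≡⟨ cong₂ _+_ (ℚ.*-identityˡ (f zero)) (sum-zero λ k → ℚ.*-zeroˡ (f (suc k))) ⟩
  f zero + 0ℚ
    ≡⟨ ℚ.+-identityʳ (f zero) ⟩
  f zero ∎
sum-is0 {suc n} f (suc i) = begin
  0ℚ * f zero + sum (λ k → is0 (distance i k) * f (suc k))
    ≡⟨ cong₂ _+_ (ℚ.*-zeroˡ (f zero)) (sum-is0 (f ∘ suc) i) ⟩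
  0ℚ + f (suc i)
    ≡⟨ ℚ.+-identityˡ (f (suc i)) ⟩
  f (suc i) ∎

-- The path has vertices 1, …, n; the term is0 (toℕ i) * h 0 adds a neighbour 0
-- of vertex 1, which makes the induction on n go through.
neighbours-from-0 : ∀ {n} (h : ℕ → ℚ) → h (suc n) ≡ 0ℚ → ∀ (i : Fin n) →
  is0 (toℕ i) * h 0 + 𝒫 (λ k → h (suc (toℕ k))) i ≡ h (toℕ i) + h (suc (suc (toℕ i)))
neighbours-from-0 {suc n} h h≡0 zero = cong₂ _+_ (ℚ.*-identityˡ (h 0)) (begin
  0ℚ * h 1 + sum (λ k → is0 (toℕ k) * h (suc (suc (toℕ {n} k))))
    ≡⟨ cong₂ _+_ (ℚ.*-zeroˡ (h 1)) (first n h≡0) ⟩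
  0ℚ + h 2
    ≡⟨ ℚ.+-identityˡ (h 2) ⟩
  h 2 ∎)
  where
  first : ∀ n → h (suc (suc n)) ≡ 0ℚ → sum (λ k → is0 (toℕ k) * h (suc (suc (toℕ {n} k)))) ≡ h 2
  first zero    h≡0 = sym h≡0
  first (suc n) h≡0 = sum-is0 {suc n} (λ k → h (suc (suc (toℕ k)))) zero
neighbours-from-0 {suc n} h h≡0 (suc i) = begin
  0ℚ * h 0 + (is0 (toℕ i) * h 1 + 𝒫 (λ k → h (suc (suc (toℕ k)))) i)
    ≡⟨ cong₂ _+_ (ℚ.*-zeroˡ (h 0)) (neighbours-from-0 (h ∘ suc) h≡0 i) ⟩
  0ℚ + (h (suc (toℕ i)) + h (suc (suc (suc (toℕ i)))))
    ≡⟨ ℚ.+-identityˡ _ ⟩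
  h (suc (toℕ i)) + h (suc (suc (suc (toℕ i)))) ∎

neighbours : ∀ {n} (h : ℕ → ℚ) → h 0 ≡ 0ℚ → h (suc n) ≡ 0ℚ → ∀ (i : Fin n) →
             𝒫 (λ k → h (suc (toℕ k))) i ≡ h (toℕ i) + h (suc (suc (toℕ i)))
neighbours h h0≡0 hn≡0 i = begin
  Q                         ≡⟨ ℚ.+-identityˡ Q ⟨
  0ℚ + Q                    ≡⟨ cong (_+ Q) (trans (cong (is0 (toℕ i) *_) h0≡0) (ℚ.*-zeroʳ (is0 (toℕ i)))) ⟨
  is0 (toℕ i) * h 0 + Q     ≡⟨ neighbours-from-0 h hn≡0 i ⟩
  h (toℕ i) + h (suc (suc (toℕ i))) ∎
  where
  Q = 𝒫 (λ k → h (suc (toℕ k))) i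

𝒫-cong : ∀ {n} {f g : Fin n → ℚ} → f ≗ g → 𝒫 f ≗ 𝒫 g
𝒫-cong {n} f≗g i = sum-cong-≗ {n} λ k → cong (is1 (distance i k) *_) (f≗g k)

𝒫-functionals : ∀ {I : Set} {n} {φ : Fin n → (I → ℚ) → ℚ} →
                (∀ k → Linear (φ k)) → ∀ i → Linear (λ f → 𝒫 (λ k → φ k f) i)
𝒫-functionals L i = sum-functionals λ k → *-linear (is1 (distance i k)) (L k)

𝒫-linear : ∀ {n} (i : Fin n) → Linear (λ f → 𝒫 f i)
𝒫-linear = 𝒫-functionals eval-linear

-- Vertices are numbered from 1, so that 0 and suc n are the boundary.
at : ∀ {n} → (Fin n → ℚ) → ℕ → ℚ
at f zero = 0ℚ
at {zero} f (suc k) = 0ℚ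
at {suc n} f (suc zero) = f zero
at {suc n} f (suc (suc k)) = at (f ∘ suc) (suc k)

at-toℕ : ∀ {n} (f : Fin n → ℚ) i → at f (suc (toℕ i)) ≡ f i
at-toℕ f zero    = refl
at-toℕ f (suc i) = at-toℕ (f ∘ suc) i

at-end : ∀ {n} (f : Fin n → ℚ) → at f (suc n) ≡ 0ℚ
at-end {zero}  f = refl
at-end {suc n} f = at-end (f ∘ suc)

at-cong : ∀ {n} {f g : Fin n → ℚ} → f ≗ g → at f ≗ at g
at-cong f≗g zero = refl
at-cong {zero} f≗g (suc k) = refl
at-cong {suc n} f≗g (suc zero) = f≗g zero
at-cong {suc n} f≗g (suc (suc k)) = at-cong (f≗g ∘ suc) (suc k)

at-fromℕ< : ∀ {n} (f : Fin n → ℚ) {k} (k<n : k < n) → at f (suc k) ≡ f (fromℕ< k<n)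
at-fromℕ< f k<n = trans (cong (at f ∘ suc) (sym (Fin.toℕ-fromℕ< k<n))) (at-toℕ f (fromℕ< k<n))

𝒫-at : ∀ {n} (f : Fin n → ℚ) i → 𝒫 f i ≡ at f (toℕ i) + at f (suc (suc (toℕ i)))
𝒫-at f i = trans (𝒫-cong (λ k → sym (at-toℕ f k)) i) (neighbours (at f) refl (at-end f) i)

𝒫-at-fromℕ< : ∀ {n} (f : Fin n → ℚ) {k} (k<n : k < n) → 𝒫 f (fromℕ< k<n) ≡ at f k + at f (suc (suc k))
𝒫-at-fromℕ< f k<n =
  trans (𝒫-at f (fromℕ< k<n)) (cong (λ k → at f k + at f (suc (suc k))) (Fin.toℕ-fromℕ< k<n))

-- Chebyshev polynomials of the second kind in 𝒫, with the index shifted so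
-- that the values at θ are sin kθ / sin θ.
U : ∀ {n} → ℕ → (Fin n → ℚ) → Fin n → ℚ
U zero          f i = 0ℚ
U (suc zero)    f i = f i
U (suc (suc k)) f i = 𝒫 (U (suc k) f) i - U k f i

U-functionals : ∀ {I : Set} {n} {φ : Fin n → (I → ℚ) → ℚ} →
                (∀ k → Linear (φ k)) → ∀ k i → Linear (λ f → U k (λ j → φ j f) i)
U-functionals L zero          i = zero-linear
U-functionals L (suc zero)    i = L i
U-functionals L (suc (suc k)) i = minus-linear (𝒫-functionals (U-functionals L (suc k)) i) (U-functionals L k i)

-- `U k` is a polynomial in 𝒫.
U-𝒫 : ∀ {n} k (f : Fin n → ℚ) → U k (𝒫 f) ≗ 𝒫 (U k f)
U-𝒫 zero          f i = sym (Linear.homo-0 (𝒫-linear i))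
U-𝒫 (suc zero)    f i = refl
U-𝒫 (suc (suc k)) f i = begin
  𝒫 (U (suc k) (𝒫 f)) i - U k (𝒫 f) i
    ≡⟨ cong₂ _-_ (𝒫-cong (U-𝒫 (suc k) f) i) (U-𝒫 k f i) ⟩
  𝒫 (𝒫 (U (suc k) f)) i - 𝒫 (U k f) i
    ≡⟨ linear-sub (𝒫-linear i) (𝒫 (U (suc k) f)) (U k f) ⟨
  𝒫 (λ j → 𝒫 (U (suc k) f) j - U k f j) i ∎

a+b-a≡b : ∀ a b → a + b - a ≡ b
a+b-a≡b = solve 2 (λ a b → a :+ b :- a := b) refl

-- Dual form of the fact that `U k` sends e₁ to e_k. One factor 𝒫 is moved inside, so that the
-- induction hypothesis applies to `𝒫 f`. The bound on `k` admits the boundary index just past the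
-- last vertex, where both sides are 0; `U-end` starts from this case.
U-first : ∀ {n} k (f : Fin (suc n) → ℚ) → k ≤ suc (suc n) → U k f zero ≡ at f k
U-first zero          f k≤ = refl
U-first (suc zero)    f k≤ = refl
U-first (suc (suc k)) f (s≤s k<n) = begin
  𝒫 (U (suc k) f) zero - U k f zero
    ≡⟨ cong₂ _-_ (sym (U-𝒫 (suc k) f zero)) (U-first k f (ℕ.m≤n⇒m≤1+n (ℕ.<⇒≤ k<n))) ⟩
  U (suc k) (𝒫 f) zero - at f k
    ≡⟨ cong (_- at f k) (U-first (suc k) (𝒫 f) (ℕ.m≤n⇒m≤1+n k<n)) ⟩
  at (𝒫 f) (suc k) - at f k
    ≡⟨ cong (_- at f k) (trans (at-fromℕ< (𝒫 f) k<n) (𝒫-at-fromℕ< f k<n)) ⟩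
  at f k + at f (suc (suc k)) - at f k
    ≡⟨ a+b-a≡b (at f k) (at f (suc (suc k))) ⟩
  at f (suc (suc k)) ∎

-- Cayley–Hamilton for the path: U (suc n) is its characteristic polynomial.
U-end : ∀ {n} (f : Fin n → ℚ) i → U (suc n) f i ≡ 0ℚ
U-end {suc n} f i = trans (sym (at-toℕ (U (suc (suc n)) f) i)) (vanish (suc (toℕ i)) f (Fin.toℕ<n i))
  where
  -- Coordinates are treated from the left, for all `f` at once: the two neighbours of coordinate
  -- `suc k` add up to a coordinate of `U (suc (suc n)) (𝒫 f)`, which the induction hypothesis for
  -- `𝒫 f` kills.
  vanish : ∀ k (f : Fin (suc n) → ℚ) → k ≤ suc n → at (U (suc (suc n)) f) k ≡ 0ℚ
  vanish zero          f k≤n = refl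
  vanish (suc zero)    f k≤n = trans (U-first (suc (suc n)) f ℕ.≤-refl) (at-end f)
  vanish (suc (suc k)) f k<n = begin
    at g (suc (suc k))
      ≡⟨ a+b-a≡b (at g k) (at g (suc (suc k))) ⟨
    at g k + at g (suc (suc k)) - at g k
      ≡⟨ cong₂ _-_ (sym (𝒫-at-fromℕ< g k<)) (vanish k f (ℕ.<⇒≤ k<)) ⟩
    𝒫 g (fromℕ< k<) - 0ℚ
      ≡⟨ cong (_- 0ℚ) (trans (sym (U-𝒫 (suc (suc n)) f (fromℕ< k<)))
                             (sym (at-fromℕ< (U (suc (suc n)) (𝒫 f)) k<))) ⟩
    at (U (suc (suc n)) (𝒫 f)) (suc k) - 0ℚ
      ≡⟨ cong (_- 0ℚ) (vanish (suc k) (𝒫 f) k<) ⟩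
    0ℚ - 0ℚ ∎
    where
    g = U (suc (suc n)) f
    k< : k < suc n
    k< = ℕ.<⇒≤ k<n

-- Functions on the grid and the commutant of the path

Grid : ℕ → Set
Grid n = Fin n → Fin n → ℚ

-- As P is symmetric, `𝒫₁ X` is the product P X and `𝒫₂ X` is X P.
𝒫₁ 𝒫₂ 𝒜 𝒟 : ∀ {n} → Grid n → Grid n
𝒫₁ X i j = 𝒫 (λ k → X k j) i
𝒫₂ X i j = 𝒫 (X i) j
𝒜 X i j = 𝒫₁ X i j + 𝒫₂ X i j
𝒟 X i j = 𝒫₁ X i j - 𝒫₂ X i j

-- The matrix Σ f_k U_k(P), the unique polynomial in P with first row `f`, written row by row: its
-- i-th row is U_i(P) f.
𝒯 : ∀ {n} → (Fin n → ℚ) → Grid n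
𝒯 f i j = U (suc (toℕ i)) f j

-- The recurrence of `U` says that the rows above and below row k add up to 𝒫 of row k. At the last
-- row this needs `U-end`: the next row would have to be 0.
𝒫₁-𝒯 : ∀ {n} (f : Fin n → ℚ) i j → 𝒫₁ (𝒯 f) i j ≡ 𝒫₂ (𝒯 f) i j
𝒫₁-𝒯 f i j = begin
  𝒫 (λ k → U (suc (toℕ k)) f j) i
    ≡⟨ neighbours (λ k → U k f j) refl (U-end f j) i ⟩
  U (toℕ i) f j + (𝒫 (U (suc (toℕ i)) f) j - U (toℕ i) f j)
    ≡⟨ solve 2 (λ a b → a :+ (b :- a) := b) refl (U (toℕ i) f j) (𝒫 (U (suc (toℕ i)) f) j) ⟩
  𝒫 (U (suc (toℕ i)) f) j ∎

-- This concerns column 0, that is, the first row of the transpose.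
𝒯-first-row : ∀ {n} (f : Fin (suc n) → ℚ) i → 𝒯 f i zero ≡ f i
𝒯-first-row f i = trans (U-first (suc (toℕ i)) f (ℕ.m≤n⇒m≤1+n (Fin.toℕ<n i))) (at-toℕ f i)

-- The equation 𝒫₁ X = 𝒫₂ X is a discrete wave equation: the rows of X satisfy
-- the recurrence of U.
commuting⇒𝒯 : ∀ {n} (X : Grid (suc n)) → (∀ i j → 𝒫₁ X i j ≡ 𝒫₂ X i j) → ∀ i j → X i j ≡ 𝒯 (X zero) i j
commuting⇒𝒯 {n} X comm i j =
  trans (sym (at-toℕ (λ k → X k j) i)) (rows (suc (toℕ i)) (Fin.toℕ<n i) j)
  where
  rows : ∀ i → i ≤ suc n → ∀ j → at (λ k → X k j) i ≡ U i (X zero) j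
  rows zero          i≤n j = refl
  rows (suc zero)    i≤n j = refl
  rows (suc (suc i)) i<n j = begin
    at (λ k → X k j) (suc (suc i))
      ≡⟨ a+b-a≡b (at (λ k → X k j) i) (at (λ k → X k j) (suc (suc i))) ⟨
    at (λ k → X k j) i + at (λ k → X k j) (suc (suc i)) - at (λ k → X k j) i
      ≡⟨ cong₂ _-_ (sym (𝒫-at-fromℕ< (λ k → X k j) i<)) (rows i (ℕ.<⇒≤ i<) j) ⟩
    𝒫₁ X (fromℕ< i<) j - U i (X zero) j
      ≡⟨ cong (_- U i (X zero) j) (comm (fromℕ< i<) j) ⟩
    𝒫 (X (fromℕ< i<)) j - U i (X zero) j
      ≡⟨ cong (_- U i (X zero) j)
           (𝒫-cong (λ k → trans (sym (at-fromℕ< (λ l → X l k) i<)) (rows (suc i) i< k)) j) ⟩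
    𝒫 (U (suc i) (X zero)) j - U i (X zero) j ∎
    where
    i< : i < suc n
    i< = ℕ.<⇒≤ i<n

-- The transpose also commutes with P and has the same first row, and the first row determines a
-- commuting matrix.
𝒯-symmetric : ∀ {n} (f : Fin (suc n) → ℚ) i j → 𝒯 f j i ≡ 𝒯 f i j
𝒯-symmetric f i j = trans
  (commuting⇒𝒯 (λ k l → 𝒯 f l k) (λ k l → sym (𝒫₁-𝒯 f l k)) i j)
  (Linear.cong-≗ (U-functionals eval-linear (suc (toℕ i)) j) (𝒯-first-row f))

-- The intertwining operator

x≡-x⇒x≡0 : ∀ {x} → x ≡ - x → x ≡ 0ℚ
x≡-x⇒x≡0 {x} x≡-x = begin
  x              ≡⟨ solve 1 (λ x → x := con ½ :* (x :+ x)) refl x ⟩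
  ½ * (x + x)    ≡⟨ cong (λ y → ½ * (x + y)) x≡-x ⟩
  ½ * (x - x)    ≡⟨ cong (½ *_) (ℚ.+-inverseʳ x) ⟩
  ½ * 0ℚ         ≡⟨ ℚ.*-zeroʳ ½ ⟩
  0ℚ             ∎

x²≥0 : ∀ x → 0ℚ ℚ.≤ x * x
x²≥0 x with ℚ.≤-total 0ℚ x
... | inj₁ 0≤x = ℚ.nonNegative⁻¹ (x * x) {{ℚ.nonNeg*nonNeg⇒nonNeg x {{nonNegative 0≤x}} x {{nonNegative 0≤x}}}}
... | inj₂ x≤0 = subst (0ℚ ℚ.≤_) (solve 1 (λ x → (:- x) :* (:- x) := x :* x) refl x)
  (ℚ.nonNegative⁻¹ (- x * - x) {{ℚ.nonNeg*nonNeg⇒nonNeg (- x) {{0≤-x}} (- x) {{0≤-x}}}})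
  where
  0≤-x : NonNegative (- x)
  0≤-x = nonNegative (ℚ.neg-antimono-≤ x≤0)

x²≡0⇒x≡0 : ∀ x → x * x ≡ 0ℚ → x ≡ 0ℚ
x²≡0⇒x≡0 x x²≡0 with x ℚ.≟ 0ℚ
... | yes x≡0 = x≡0
... | no x≢0 = begin
  x              ≡⟨ ℚ.*-identityˡ x ⟨
  1ℚ * x         ≡⟨ cong (_* x) (ℚ.*-inverseˡ x) ⟨
  1/ x * x * x   ≡⟨ ℚ.*-assoc (1/ x) x x ⟩
  1/ x * (x * x) ≡⟨ cong (1/ x *_) x²≡0 ⟩
  1/ x * 0ℚ      ≡⟨ ℚ.*-zeroʳ (1/ x) ⟩
  0ℚ             ∎
  where
  instance
    x-nonZero = ≢-nonZero x≢0

x+y≡0⇒x≡0 : ∀ {x y} → 0ℚ ℚ.≤ x → 0ℚ ℚ.≤ y → x + y ≡ 0ℚ → x ≡ 0ℚ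
x+y≡0⇒x≡0 {x} {y} 0≤x 0≤y x+y≡0 = ℚ.≤-antisym
  (subst₂ ℚ._≤_ (ℚ.+-identityʳ x) x+y≡0 (ℚ.+-monoʳ-≤ x 0≤y)) 0≤x

sum-nonNeg : ∀ {n} {f : Fin n → ℚ} → (∀ i → 0ℚ ℚ.≤ f i) → 0ℚ ℚ.≤ sum f
sum-nonNeg {zero}  f≥0 = ℚ.≤-refl
sum-nonNeg {suc n} {f} f≥0 = subst (ℚ._≤ sum f) (ℚ.+-identityʳ 0ℚ) (ℚ.+-mono-≤ (f≥0 zero) (sum-nonNeg (f≥0 ∘ suc)))

sum-nonNeg≡0 : ∀ {n} {f : Fin n → ℚ} → (∀ i → 0ℚ ℚ.≤ f i) → sum f ≡ 0ℚ → ∀ i → f i ≡ 0ℚ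
sum-nonNeg≡0 {suc n} {f} f≥0 Σ≡0 zero = x+y≡0⇒x≡0 (f≥0 zero) (sum-nonNeg (f≥0 ∘ suc)) Σ≡0
sum-nonNeg≡0 {suc n} {f} f≥0 Σ≡0 (suc i) = sum-nonNeg≡0 (f≥0 ∘ suc)
  (x+y≡0⇒x≡0 (sum-nonNeg (f≥0 ∘ suc)) (f≥0 zero) (trans (ℚ.+-comm (sum (f ∘ suc)) (f zero)) Σ≡0)) i

sum-sub : ∀ {n} (f g : Fin n → ℚ) → sum (λ i → f i - g i) ≡ sum f - sum g
sum-sub = linear-sub (sum-functionals eval-linear)

𝒫₁-𝒫₂-comm : ∀ {n} (X : Grid n) i j → 𝒫₁ (𝒫₂ X) i j ≡ 𝒫₂ (𝒫₁ X) i j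
𝒫₁-𝒫₂-comm {n} X i j = trans
  (Linear.homo-sum (𝒫-linear i) (λ l k → is1 (distance j l) * X k l))
  (sum-cong-≗ {n} λ l → Linear.homo-* (𝒫-linear i) (is1 (distance j l)) (λ k → X k l))

𝒟-cong : ∀ {n} {X Y : Grid n} → (∀ i j → X i j ≡ Y i j) → ∀ i j → 𝒟 X i j ≡ 𝒟 Y i j
𝒟-cong X≡Y i j = cong₂ _-_ (𝒫-cong (λ k → X≡Y k j) i) (𝒫-cong (X≡Y i) j)

𝒜-+ : ∀ {n} (X Y : Grid n) i j → 𝒜 (λ k l → X k l + Y k l) i j ≡ 𝒜 X i j + 𝒜 Y i j
𝒜-+ X Y i j = trans
  (cong₂ _+_ (Linear.homo-+ (𝒫-linear i) (λ k → X k j) (λ k → Y k j)) (Linear.homo-+ (𝒫-linear j) (X i) (Y i)))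
  (solve 4 (λ a b c d → (a :+ b) :+ (c :+ d) := (a :+ c) :+ (b :+ d)) refl
    (𝒫₁ X i j) (𝒫₁ Y i j) (𝒫₂ X i j) (𝒫₂ Y i j))

-- Both composites are 𝒫₁² - 𝒫₂², since left and right multiplication commute.
𝒜-𝒟-comm : ∀ {n} (X : Grid n) i j → 𝒜 (𝒟 X) i j ≡ 𝒟 (𝒜 X) i j
𝒜-𝒟-comm X i j = begin
  𝒫₁ (𝒟 X) i j + 𝒫₂ (𝒟 X) i j
    ≡⟨ cong₂ _+_ (linear-sub (𝒫-linear i) (λ k → 𝒫₁ X k j) (λ k → 𝒫₂ X k j))
                 (linear-sub (𝒫-linear j) (𝒫₁ X i) (𝒫₂ X i)) ⟩
  𝒫₁ (𝒫₁ X) i j - 𝒫₁ (𝒫₂ X) i j + (𝒫₂ (𝒫₁ X) i j - 𝒫₂ (𝒫₂ X) i j)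
    ≡⟨ cong (λ u → 𝒫₁ (𝒫₁ X) i j - u + (𝒫₂ (𝒫₁ X) i j - 𝒫₂ (𝒫₂ X) i j)) (𝒫₁-𝒫₂-comm X i j) ⟩
  𝒫₁ (𝒫₁ X) i j - 𝒫₂ (𝒫₁ X) i j + (𝒫₂ (𝒫₁ X) i j - 𝒫₂ (𝒫₂ X) i j)
    ≡⟨ solve 3 (λ a b c → a :- b :+ (b :- c) := a :+ b :- (b :+ c)) refl
         (𝒫₁ (𝒫₁ X) i j) (𝒫₂ (𝒫₁ X) i j) (𝒫₂ (𝒫₂ X) i j) ⟩
  𝒫₁ (𝒫₁ X) i j + 𝒫₂ (𝒫₁ X) i j - (𝒫₂ (𝒫₁ X) i j + 𝒫₂ (𝒫₂ X) i j)
    ≡⟨ cong (λ u → 𝒫₁ (𝒫₁ X) i j + u - (𝒫₂ (𝒫₁ X) i j + 𝒫₂ (𝒫₂ X) i j)) (𝒫₁-𝒫₂-comm X i j) ⟨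
  𝒫₁ (𝒫₁ X) i j + 𝒫₁ (𝒫₂ X) i j - (𝒫₂ (𝒫₁ X) i j + 𝒫₂ (𝒫₂ X) i j)
    ≡⟨ cong₂ _-_ (Linear.homo-+ (𝒫-linear i) (λ k → 𝒫₁ X k j) (λ k → 𝒫₂ X k j))
                 (Linear.homo-+ (𝒫-linear j) (𝒫₁ X i) (𝒫₂ X i)) ⟨
  𝒟 (𝒜 X) i j ∎

-- The Frobenius inner product and self-adjointness

𝒫-selfAdjoint : ∀ {n} (f g : Fin n → ℚ) → sum (λ i → 𝒫 f i * g i) ≡ sum (λ i → f i * 𝒫 g i)
𝒫-selfAdjoint {n} f g = begin
  sum (λ i → sum (λ k → p i k * f k) * g i)
    ≡⟨ sum-cong-≗ {n} (λ i → *-distribʳ-sum (g i) (λ k → p i k * f k)) ⟩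
  sum (λ i → sum (λ k → p i k * f k * g i))
    ≡⟨ ∑-comm (λ i k → p i k * f k * g i) ⟩
  sum (λ k → sum (λ i → p i k * f k * g i))
    ≡⟨ sum-cong-≗ {n} (λ k → sum-cong-≗ {n} λ i → trans
         (cong (λ d → is1 d * f k * g i) (ℕ.∣-∣-comm (toℕ i) (toℕ k)))
         (solve 3 (λ p f g → p :* f :* g := f :* (p :* g)) refl (p k i) (f k) (g i))) ⟩
  sum (λ k → sum (λ i → f k * (p k i * g i)))
    ≡⟨ sum-cong-≗ {n} (λ k → *-distribˡ-sum (f k) (λ i → p k i * g i)) ⟨
  sum (λ k → f k * sum (λ i → p k i * g i)) ∎
  where
  p : Fin n → Fin n → ℚ
  p i k = is1 (distance i k)

⟨_,_⟩ : ∀ {n} → Grid n → Grid n → ℚ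
⟨ X , Y ⟩ = sum λ i → sum λ j → X i j * Y i j

⟨,⟩-subˡ : ∀ {n} (X Y Z : Grid n) → ⟨ (λ i j → X i j - Y i j) , Z ⟩ ≡ ⟨ X , Z ⟩ - ⟨ Y , Z ⟩
⟨,⟩-subˡ {n} X Y Z = trans
  (sum-cong-≗ {n} λ i → trans
    (sum-cong-≗ {n} λ j → solve 3 (λ x y z → (x :- y) :* z := x :* z :- y :* z) refl (X i j) (Y i j) (Z i j))
    (sum-sub (λ j → X i j * Z i j) (λ j → Y i j * Z i j)))
  (sum-sub (λ i → sum λ j → X i j * Z i j) (λ i → sum λ j → Y i j * Z i j))

⟨,⟩-comm : ∀ {n} (X Y : Grid n) → ⟨ X , Y ⟩ ≡ ⟨ Y , X ⟩
⟨,⟩-comm {n} X Y = sum-cong-≗ {n} λ i → sum-cong-≗ {n} λ j → ℚ.*-comm (X i j) (Y i j)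

𝒟-selfAdjoint : ∀ {n} (X Y : Grid n) → ⟨ 𝒟 X , Y ⟩ ≡ ⟨ X , 𝒟 Y ⟩
𝒟-selfAdjoint {n} X Y = begin
  ⟨ 𝒟 X , Y ⟩                      ≡⟨ ⟨,⟩-subˡ (𝒫₁ X) (𝒫₂ X) Y ⟩
  ⟨ 𝒫₁ X , Y ⟩ - ⟨ 𝒫₂ X , Y ⟩      ≡⟨ cong₂ _-_ vertical horizontal ⟩
  ⟨ X , 𝒫₁ Y ⟩ - ⟨ X , 𝒫₂ Y ⟩      ≡⟨ cong₂ _-_ (⟨,⟩-comm X (𝒫₁ Y)) (⟨,⟩-comm X (𝒫₂ Y)) ⟩
  ⟨ 𝒫₁ Y , X ⟩ - ⟨ 𝒫₂ Y , X ⟩      ≡⟨ ⟨,⟩-subˡ (𝒫₁ Y) (𝒫₂ Y) X ⟨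
  ⟨ 𝒟 Y , X ⟩                      ≡⟨ ⟨,⟩-comm (𝒟 Y) X ⟩
  ⟨ X , 𝒟 Y ⟩                      ∎
  where
  horizontal : ⟨ 𝒫₂ X , Y ⟩ ≡ ⟨ X , 𝒫₂ Y ⟩
  horizontal = sum-cong-≗ {n} λ i → 𝒫-selfAdjoint (X i) (Y i)

  vertical : ⟨ 𝒫₁ X , Y ⟩ ≡ ⟨ X , 𝒫₁ Y ⟩
  vertical = begin
    sum (λ i → sum λ j → 𝒫₁ X i j * Y i j)  ≡⟨ ∑-comm (λ i j → 𝒫₁ X i j * Y i j) ⟩
    sum (λ j → sum λ i → 𝒫₁ X i j * Y i j)  ≡⟨ sum-cong-≗ {n} (λ j → 𝒫-selfAdjoint (λ k → X k j) (λ k → Y k j)) ⟩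
    sum (λ j → sum λ i → X i j * 𝒫₁ Y i j)  ≡⟨ ∑-comm (λ i j → X i j * 𝒫₁ Y i j) ⟨
    sum (λ i → sum λ j → X i j * 𝒫₁ Y i j)  ∎

⟨X,X⟩≡0⇒X≡0 : ∀ {n} (X : Grid n) → ⟨ X , X ⟩ ≡ 0ℚ → ∀ i j → X i j ≡ 0ℚ
⟨X,X⟩≡0⇒X≡0 X XX≡0 i j = x²≡0⇒x≡0 (X i j) (sum-nonNeg≡0 (λ l → x²≥0 (X i l))
  (sum-nonNeg≡0 (λ k → sum-nonNeg λ l → x²≥0 (X k l)) XX≡0 i) j)

𝒟²≡0⇒𝒟≡0 : ∀ {n} (X : Grid n) → (∀ i j → 𝒟 (𝒟 X) i j ≡ 0ℚ) → ∀ i j → 𝒟 X i j ≡ 0ℚ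
𝒟²≡0⇒𝒟≡0 {n} X 𝒟²X≡0 = ⟨X,X⟩≡0⇒X≡0 (𝒟 X) (trans (𝒟-selfAdjoint X (𝒟 X))
  (sum-zero λ i → sum-zero λ j → trans (cong (X i j *_) (𝒟²X≡0 i j)) (ℚ.*-zeroʳ (X i j))))

-- Tri n indexes the pairs (lo u , hi u) with lo u < hi u, row by row.
Tri : ℕ → Set
Tri zero    = ⊥
Tri (suc n) = Fin n ⊎ Tri n

lo hi : ∀ {n} → Tri n → Fin n
lo {suc n} (inj₁ j) = zero
lo {suc n} (inj₂ u) = suc (lo u)
hi {suc n} (inj₁ j) = suc j
hi {suc n} (inj₂ u) = suc (hi u)

triCases : ∀ {n} (P : Fin n → Fin n → Set) →
           (∀ i → P i i) → (∀ u → P (lo u) (hi u)) → (∀ u → P (hi u) (lo u)) → ∀ i j → P i j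
triCases P diag upper lower zero    zero    = diag zero
triCases P diag upper lower zero    (suc j) = upper (inj₁ j)
triCases P diag upper lower (suc i) zero    = lower (inj₁ i)
triCases P diag upper lower (suc i) (suc j) =
  triCases (λ k l → P (suc k) (suc l)) (diag ∘ suc) (upper ∘ inj₂) (lower ∘ inj₂) i j

sumTri : ∀ {n} → (Tri n → ℚ) → ℚ
sumTri {zero}  f = 0ℚ
sumTri {suc n} f = sum (f ∘ inj₁) + sumTri (f ∘ inj₂)

sumTri-cong : ∀ {n} {f g : Tri n → ℚ} → f ≗ g → sumTri f ≡ sumTri g
sumTri-cong {zero}  f≗g = refl
sumTri-cong {suc n} f≗g = cong₂ _+_ (sum-cong-≗ {n} (f≗g ∘ inj₁)) (sumTri-cong (f≗g ∘ inj₂))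

sum-triangles : ∀ {n} (X : Grid n) →
  sum (λ i → sum λ j → X i j) ≡ sum (λ i → X i i) + sumTri (λ u → X (lo u) (hi u) + X (hi u) (lo u))
sum-triangles {zero}  X = refl
sum-triangles {suc n} X = begin
  x + row + sum (λ i → X (suc i) zero + sum λ j → X (suc i) (suc j))
    ≡⟨ cong (x + row +_) (∑-distrib-+ (λ i → X (suc i) zero) (λ i → sum λ j → X (suc i) (suc j))) ⟩
  x + row + (col + sum (λ i → sum λ j → X (suc i) (suc j)))
    ≡⟨ cong (λ s → x + row + (col + s)) (sum-triangles (λ i j → X (suc i) (suc j))) ⟩
  x + row + (col + (d + t))
    ≡⟨ solve 5 (λ x r c d t → x :+ r :+ (c :+ (d :+ t)) := x :+ d :+ (r :+ c :+ t)) refl x row col d t ⟩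
  x + d + (row + col + t)
    ≡⟨ cong (λ s → x + d + (s + t)) (∑-distrib-+ (λ j → X zero (suc j)) (λ i → X (suc i) zero)) ⟨
  x + d + (sum (λ j → X zero (suc j) + X (suc j) zero) + t) ∎
  where
  x row col d t : ℚ
  x   = X zero zero
  row = sum λ j → X zero (suc j)
  col = sum λ i → X (suc i) zero
  d   = sum λ i → X (suc i) (suc i)
  t   = sumTri λ u → X (suc (lo u)) (suc (hi u)) + X (suc (hi u)) (suc (lo u))

-- A step of ℓ¹-length 1 moves exactly one coordinate: the grid is the Cartesian product of two
-- paths, with adjacency matrix P ⊗ 1 + 1 ⊗ P.
is1-+ : ∀ d e → is1 (d ℕ.+ e) ≡ is1 d * is0 e + is0 d * is1 e
is1-+ zero          e = solve 2 (λ u v → v := con 0ℚ :* u :+ con 1ℚ :* v) refl (is0 e) (is1 e)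
is1-+ (suc zero)    e = solve 2 (λ u v → u := con 1ℚ :* u :+ con 0ℚ :* v) refl (is0 e) (is1 e)
is1-+ (suc (suc d)) e = solve 2 (λ u v → con 0ℚ := con 0ℚ :* u :+ con 0ℚ :* v) refl (is0 e) (is1 e)

𝒜-adjacency : ∀ {n} (X : Grid n) i j →
  sum (λ k → sum λ l → is1 (distance i k ℕ.+ distance j l) * X k l) ≡ 𝒜 X i j
𝒜-adjacency {n} X i j = begin
  sum (λ k → sum λ l → is1 (distance i k ℕ.+ distance j l) * X k l)
    ≡⟨ sum-cong-≗ {n} inner ⟩
  sum (λ k → is1 (distance i k) * X k j + is0 (distance i k) * 𝒫₂ X k j)
    ≡⟨ ∑-distrib-+ (λ k → is1 (distance i k) * X k j) (λ k → is0 (distance i k) * 𝒫₂ X k j) ⟩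
  𝒫₁ X i j + sum (λ k → is0 (distance i k) * 𝒫₂ X k j)
    ≡⟨ cong (𝒫₁ X i j +_) (sum-is0 (λ k → 𝒫₂ X k j) i) ⟩
  𝒜 X i j ∎
  where
  inner : ∀ k → sum (λ l → is1 (distance i k ℕ.+ distance j l) * X k l) ≡
                is1 (distance i k) * X k j + is0 (distance i k) * 𝒫₂ X k j
  inner k = begin
    sum (λ l → is1 (distance i k ℕ.+ distance j l) * X k l)
      ≡⟨ sum-cong-≗ {n} (λ l → trans (cong (_* X k l) (is1-+ (distance i k) (distance j l)))
           (solve 5 (λ a b c d x → (a :* b :+ c :* d) :* x := a :* (b :* x) :+ c :* (d :* x)) refl
             (is1 (distance i k)) (is0 (distance j l)) (is0 (distance i k)) (is1 (distance j l)) (X k l))) ⟩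
    sum (λ l → is1 (distance i k) * (is0 (distance j l) * X k l) + is0 (distance i k) * (is1 (distance j l) * X k l))
      ≡⟨ sum-linear (is1 (distance i k)) (is0 (distance i k)) (λ l → is0 (distance j l) * X k l) (λ l → is1 (distance j l) * X k l) ⟩
    is1 (distance i k) * sum (λ l → is0 (distance j l) * X k l) + is0 (distance i k) * 𝒫₂ X k j
      ≡⟨ cong (λ s → is1 (distance i k) * s + is0 (distance i k) * 𝒫₂ X k j) (sum-is0 (X k) j) ⟩
    is1 (distance i k) * X k j + is0 (distance i k) * 𝒫₂ X k j ∎

triDistance : ∀ {n} → Tri n → Tri n → ℕ
triDistance u v = distance (lo u) (lo v) ℕ.+ distance (hi u) (hi v)

-- The adjacency operator of the strict upper triangle; `qad-adjacency` identifies it with that of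
-- the quartered Aztec diamond.
𝒬 : ∀ {n} → (Tri n → ℚ) → Tri n → ℚ
𝒬 b u = sumTri λ v → is1 (triDistance u v) * b v

is0-hi : ∀ {n} (u : Tri n) d → is0 (toℕ (hi u) ℕ.+ d) ≡ 0ℚ
is0-hi {suc n} (inj₁ j) d = refl
is0-hi {suc n} (inj₂ u) d = refl

-- No edge of the grid crosses the diagonal.
mirror-nonadjacent : ∀ {n} (u v : Tri n) → is1 (distance (lo u) (hi v) ℕ.+ distance (hi u) (lo v)) ≡ 0ℚ
mirror-nonadjacent {suc n} (inj₁ j) (inj₁ k) = cong is0 (ℕ.+-suc (toℕ k) (toℕ j))
mirror-nonadjacent {suc n} (inj₁ j) (inj₂ v) = is0-hi v (distance j (lo v))
mirror-nonadjacent {suc n} (inj₂ u) (inj₁ k) = begin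
  is1 (distance (lo u) k ℕ.+ suc (toℕ (hi u)))  ≡⟨ cong is1 (ℕ.+-comm (distance (lo u) k) (suc (toℕ (hi u)))) ⟩
  is0 (toℕ (hi u) ℕ.+ distance (lo u) k)        ≡⟨ is0-hi u (distance (lo u) k) ⟩
  0ℚ                                            ∎
mirror-nonadjacent {suc n} (inj₂ u) (inj₂ v) = mirror-nonadjacent u v

Alt : ∀ {n} → (Tri n → ℚ) → Grid n
Alt {suc n} b zero    zero    = 0ℚ
Alt {suc n} b zero    (suc j) = b (inj₁ j)
Alt {suc n} b (suc i) zero    = - b (inj₁ i)
Alt {suc n} b (suc i) (suc j) = Alt (b ∘ inj₂) i j

Alt-upper : ∀ {n} (b : Tri n → ℚ) u → Alt b (lo u) (hi u) ≡ b u
Alt-upper {suc n} b (inj₁ j) = refl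
Alt-upper {suc n} b (inj₂ u) = Alt-upper (b ∘ inj₂) u

Alt-diagonal : ∀ {n} (b : Tri n → ℚ) i → Alt b i i ≡ 0ℚ
Alt-diagonal b zero    = refl
Alt-diagonal b (suc i) = Alt-diagonal (b ∘ inj₂) i

Antisymmetric : ∀ {n} → Grid n → Set
Antisymmetric X = ∀ i j → X j i ≡ - X i j

Alt-antisymmetric : ∀ {n} (b : Tri n → ℚ) → Antisymmetric (Alt b)
Alt-antisymmetric b zero    zero    = refl
Alt-antisymmetric b zero    (suc j) = refl
Alt-antisymmetric b (suc i) zero    = solve 1 (λ x → x := :- (:- x)) refl (b (inj₁ i))
Alt-antisymmetric b (suc i) (suc j) = Alt-antisymmetric (b ∘ inj₂) i j

Alt-linear : ∀ {n} (i j : Fin n) → Linear (λ b → Alt b i j)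
Alt-linear zero    zero    = zero-linear
Alt-linear zero    (suc j) = eval-linear (inj₁ j)
Alt-linear (suc i) zero    = Linear-resp-≗ (λ b → ℚ.+-identityˡ (- b (inj₁ i))) (minus-linear zero-linear (eval-linear (inj₁ i)))
Alt-linear (suc i) (suc j) = precompose-linear inj₂ (Alt-linear i j)

antisymmetric-ext : ∀ {n} {X Y : Grid n} → Antisymmetric X → Antisymmetric Y →
  (∀ u → X (lo u) (hi u) ≡ Y (lo u) (hi u)) → ∀ i j → X i j ≡ Y i j
antisymmetric-ext {X = X} {Y} X-anti Y-anti eq = triCases (λ i j → X i j ≡ Y i j)
  (λ i → trans (x≡-x⇒x≡0 (X-anti i i)) (sym (x≡-x⇒x≡0 (Y-anti i i))))
  eq
  (λ u → trans (X-anti (lo u) (hi u)) (trans (cong -_ (eq u)) (sym (Y-anti (lo u) (hi u)))))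

-- The transpose of P X is Xᵀ P, which is - X P.
𝒫-transpose : ∀ {n} {X : Grid n} → Antisymmetric X → ∀ i j → 𝒫₁ X j i ≡ - 𝒫₂ X i j
𝒫-transpose {X = X} X-anti i j = begin
  𝒫 (λ k → X k i) j              ≡⟨ 𝒫-cong (λ k → trans (X-anti i k) (sym (ℚ.+-identityˡ (- X i k)))) j ⟩
  𝒫 (λ k → 0ℚ - X i k) j         ≡⟨ linear-sub (𝒫-linear j) (λ _ → 0ℚ) (X i) ⟩
  𝒫 (λ _ → 0ℚ) j - 𝒫 (X i) j     ≡⟨ cong (_- 𝒫 (X i) j) (Linear.homo-0 (𝒫-linear j)) ⟩
  0ℚ - 𝒫 (X i) j                 ≡⟨ ℚ.+-identityˡ (- 𝒫 (X i) j) ⟩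
  - 𝒫 (X i) j                    ∎

y≡-x⇒x≡-y : ∀ {x y} → y ≡ - x → x ≡ - y
y≡-x⇒x≡-y {x} y≡-x = trans (solve 1 (λ x → x := :- (:- x)) refl x) (cong -_ (sym y≡-x))

𝒜-antisymmetric : ∀ {n} {X : Grid n} → Antisymmetric X → Antisymmetric (𝒜 X)
𝒜-antisymmetric {X = X} X-anti i j = begin
  𝒫₁ X j i + 𝒫₂ X j i          ≡⟨ cong₂ _+_ (𝒫-transpose X-anti i j) (y≡-x⇒x≡-y (𝒫-transpose X-anti j i)) ⟩
  - 𝒫₂ X i j - 𝒫₁ X i j        ≡⟨ solve 2 (λ a b → (:- a) :- b := :- (b :+ a)) refl (𝒫₂ X i j) (𝒫₁ X i j) ⟩
  - 𝒜 X i j                    ∎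

𝒟-symmetric : ∀ {n} {X : Grid n} → Antisymmetric X → ∀ i j → 𝒟 X j i ≡ 𝒟 X i j
𝒟-symmetric {X = X} X-anti i j = begin
  𝒫₁ X j i - 𝒫₂ X j i          ≡⟨ cong₂ _-_ (𝒫-transpose X-anti i j) (y≡-x⇒x≡-y (𝒫-transpose X-anti j i)) ⟩
  - 𝒫₂ X i j - (- 𝒫₁ X i j)    ≡⟨ solve 2 (λ a b → (:- a) :- (:- b) := b :- a) refl (𝒫₂ X i j) (𝒫₁ X i j) ⟩
  𝒟 X i j                      ∎

-- The sum over the grid is folded along the diagonal. Diagonal terms vanish because `Alt b` does,
-- mirrored terms because their points are not adjacent to `u`.
𝒜-Alt-upper : ∀ {n} (b : Tri n → ℚ) u → 𝒜 (Alt b) (lo u) (hi u) ≡ 𝒬 b u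
𝒜-Alt-upper {n} b u = begin
  𝒜 (Alt b) (lo u) (hi u)
    ≡⟨ 𝒜-adjacency (Alt b) (lo u) (hi u) ⟨
  sum (λ k → sum λ l → a k l * Alt b k l)
    ≡⟨ sum-triangles (λ k l → a k l * Alt b k l) ⟩
  sum (λ k → a k k * Alt b k k) + sumTri (λ v → a (lo v) (hi v) * Alt b (lo v) (hi v) + a (hi v) (lo v) * Alt b (hi v) (lo v))
    ≡⟨ cong₂ _+_ (sum-zero λ k → trans (cong (a k k *_) (Alt-diagonal b k)) (ℚ.*-zeroʳ (a k k)))
                 (sumTri-cong off-diagonal) ⟩
  0ℚ + 𝒬 b u
    ≡⟨ ℚ.+-identityˡ (𝒬 b u) ⟩
  𝒬 b u ∎
  where
  a : Grid n
  a k l = is1 (distance (lo u) k ℕ.+ distance (hi u) l)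

  off-diagonal : ∀ v → a (lo v) (hi v) * Alt b (lo v) (hi v) + a (hi v) (lo v) * Alt b (hi v) (lo v) ≡
                       is1 (triDistance u v) * b v
  off-diagonal v = begin
    a (lo v) (hi v) * Alt b (lo v) (hi v) + a (hi v) (lo v) * Alt b (hi v) (lo v)
      ≡⟨ cong₂ (λ x y → a (lo v) (hi v) * x + y * Alt b (hi v) (lo v)) (Alt-upper b v) (mirror-nonadjacent u v) ⟩
    a (lo v) (hi v) * b v + 0ℚ * Alt b (hi v) (lo v)
      ≡⟨ solve 2 (λ x y → x :+ con 0ℚ :* y := x) refl (a (lo v) (hi v) * b v) (Alt b (hi v) (lo v)) ⟩
    a (lo v) (hi v) * b v ∎

𝒜-Alt : ∀ {n} (b : Tri n → ℚ) i j → 𝒜 (Alt b) i j ≡ Alt (𝒬 b) i j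
𝒜-Alt b = antisymmetric-ext (𝒜-antisymmetric (Alt-antisymmetric b)) (Alt-antisymmetric (𝒬 b))
  (λ u → trans (𝒜-Alt-upper b u) (sym (Alt-upper (𝒬 b) u)))

-- The intertwiner of the three parts and its injectivity

2ℚ : ℚ
2ℚ = 1ℚ + 1ℚ

-- The origin of the weight 2: on a commuting matrix the two halves of 𝒜 coincide. The factor P then
-- passes through the polynomial `U` to `f`.
𝒜-𝒯 : ∀ {n} (f : Fin n → ℚ) i j → 𝒜 (𝒯 f) i j ≡ 𝒯 (λ k → 2ℚ * 𝒫 f k) i j
𝒜-𝒯 f i j = begin
  𝒫₁ (𝒯 f) i j + 𝒫₂ (𝒯 f) i j      ≡⟨ cong (_+ 𝒫₂ (𝒯 f) i j) (𝒫₁-𝒯 f i j) ⟩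
  𝒫₂ (𝒯 f) i j + 𝒫₂ (𝒯 f) i j      ≡⟨ solve 1 (λ x → x :+ x := (con 1ℚ :+ con 1ℚ) :* x) refl (𝒫₂ (𝒯 f) i j) ⟩
  2ℚ * 𝒫 (U (suc (toℕ i)) f) j     ≡⟨ cong (2ℚ *_) (U-𝒫 (suc (toℕ i)) f j) ⟨
  2ℚ * U (suc (toℕ i)) (𝒫 f) j     ≡⟨ Linear.homo-* (U-functionals eval-linear (suc (toℕ i)) j) 2ℚ (𝒫 f) ⟨
  𝒯 (λ k → 2ℚ * 𝒫 f k) i j         ∎

Parts : ℕ → Set
Parts n = Tri n ⊎ Tri n ⊎ Fin n

ℳ : ∀ {n} → (Parts n → ℚ) → Grid n
ℳ f i j = Alt (f ∘ inj₁) i j + (𝒟 (Alt (f ∘ inj₂ ∘ inj₁)) i j + 𝒯 (f ∘ inj₂ ∘ inj₂) i j)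

ℬ : ∀ {n} → (Parts n → ℚ) → Parts n → ℚ
ℬ f (inj₁ u)        = 𝒬 (f ∘ inj₁) u
ℬ f (inj₂ (inj₁ u)) = 𝒬 (f ∘ inj₂ ∘ inj₁) u
ℬ f (inj₂ (inj₂ i)) = 2ℚ * 𝒫 (f ∘ inj₂ ∘ inj₂) i

ℳ-linear : ∀ {n} (i j : Fin n) → Linear (λ f → ℳ f i j)
ℳ-linear i j = +-linear (precompose-linear inj₁ (Alt-linear i j)) (+-linear
  (precompose-linear (inj₂ ∘ inj₁)
    (minus-linear (𝒫-functionals (λ k → Alt-linear k j) i) (𝒫-functionals (Alt-linear i) j)))
  (precompose-linear (inj₂ ∘ inj₂) (U-functionals eval-linear (suc (toℕ i)) j)))

𝒜-ℳ : ∀ {n} (f : Parts n → ℚ) i j → 𝒜 (ℳ f) i j ≡ ℳ (ℬ f) i j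
𝒜-ℳ f i j = trans (𝒜-+ (Alt a) (λ k l → 𝒟 (Alt b) k l + 𝒯 p k l) i j)
  (cong₂ _+_ (𝒜-Alt a i j) (trans (𝒜-+ (𝒟 (Alt b)) (𝒯 p) i j)
    (cong₂ _+_ (trans (𝒜-𝒟-comm (Alt b) i j) (𝒟-cong (𝒜-Alt b) i j)) (𝒜-𝒯 p i j))))
  where
  a = f ∘ inj₁
  b = f ∘ inj₂ ∘ inj₁
  p = f ∘ inj₂ ∘ inj₂

-- Such an `X` is 𝒯 of its first row, hence symmetric as well.
antisymmetric∧commuting⇒0 : ∀ {n} (X : Grid (suc n)) → Antisymmetric X → (∀ i j → 𝒟 X i j ≡ 0ℚ) → ∀ i j → X i j ≡ 0ℚ
antisymmetric∧commuting⇒0 X X-anti 𝒟X≡0 i j = x≡-x⇒x≡0 (begin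
  X i j            ≡⟨ X≡𝒯 i j ⟩
  𝒯 (X zero) i j   ≡⟨ 𝒯-symmetric (X zero) j i ⟩
  𝒯 (X zero) j i   ≡⟨ X≡𝒯 j i ⟨
  X j i            ≡⟨ X-anti i j ⟩
  - X i j          ∎)
  where
  X≡𝒯 : ∀ i j → X i j ≡ 𝒯 (X zero) i j
  X≡𝒯 = commuting⇒𝒯 X λ i j → x∙y⁻¹≈ε⇒x≈y (𝒫₁ X i j) (𝒫₂ X i j) (𝒟X≡0 i j)

ℳ-injective : ∀ {n} (f : Parts (suc n) → ℚ) → (∀ i j → ℳ f i j ≡ 0ℚ) → ∀ w → f w ≡ 0ℚ
ℳ-injective {n} f ℳf≡0 = λ where
    (inj₁ u)        → trans (sym (Alt-upper a u)) (X≡0 (lo u) (hi u))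
    (inj₂ (inj₁ u)) → trans (sym (Alt-upper b u)) (Y≡0 (lo u) (hi u))
    (inj₂ (inj₂ i)) → trans (sym (𝒯-first-row p i)) (Z≡0 i zero)
  where
  a = f ∘ inj₁
  b = f ∘ inj₂ ∘ inj₁
  p = f ∘ inj₂ ∘ inj₂

  X Y S : Grid (suc n)
  X = Alt a
  Y = Alt b
  S i j = 𝒟 Y i j + 𝒯 p i j

  S-symmetric : ∀ i j → S j i ≡ S i j
  S-symmetric i j = cong₂ _+_ (𝒟-symmetric (Alt-antisymmetric b) i j) (𝒯-symmetric p i j)

  -- The antisymmetric summand `X` and the symmetric remainder `S` add up to 0, so each of them
  -- vanishes.
  X≡0 : ∀ i j → X i j ≡ 0ℚ
  X≡0 i j = x≡-x⇒x≡0 (begin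
    X i j                         ≡⟨ a+b-a≡b (S i j) (X i j) ⟨
    S i j + X i j - S i j         ≡⟨ cong (_- S i j) (trans (ℚ.+-comm (S i j) (X i j)) (trans (ℳf≡0 i j) (sym (ℳf≡0 j i)))) ⟩
    X j i + S j i - S i j         ≡⟨ cong₂ (λ x s → x + s - S i j) (Alt-antisymmetric a i j) (S-symmetric i j) ⟩
    - X i j + S i j - S i j       ≡⟨ solve 2 (λ x s → (:- x) :+ s :- s := :- x) refl (X i j) (S i j) ⟩
    - X i j                       ∎)

  S≡0 : ∀ i j → S i j ≡ 0ℚ
  S≡0 i j = trans (sym (ℚ.+-identityˡ (S i j))) (trans (cong (_+ S i j) (sym (X≡0 i j))) (ℳf≡0 i j))

  -- The sign is absorbed into the argument of 𝒯, so that `𝒟 Y` visibly lies in the kernel of 𝒟.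
  𝒟Y≡𝒯 : ∀ i j → 𝒟 Y i j ≡ 𝒯 (λ k → (- 1ℚ) * p k) i j
  𝒟Y≡𝒯 i j = begin
    𝒟 Y i j                   ≡⟨ solve 2 (λ d t → d := d :+ t :+ (:- con 1ℚ) :* t) refl (𝒟 Y i j) (𝒯 p i j) ⟩
    S i j + (- 1ℚ) * 𝒯 p i j  ≡⟨ cong (_+ (- 1ℚ) * 𝒯 p i j) (S≡0 i j) ⟩
    0ℚ + (- 1ℚ) * 𝒯 p i j     ≡⟨ ℚ.+-identityˡ ((- 1ℚ) * 𝒯 p i j) ⟩
    (- 1ℚ) * 𝒯 p i j          ≡⟨ Linear.homo-* (U-functionals eval-linear (suc (toℕ i)) j) (- 1ℚ) p ⟨
    𝒯 (λ k → (- 1ℚ) * p k) i j ∎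

  𝒟𝒯≡0 : ∀ q i j → 𝒟 (𝒯 q) i j ≡ 0ℚ
  𝒟𝒯≡0 q i j = trans (cong (_- 𝒫₂ (𝒯 q) i j) (𝒫₁-𝒯 q i j)) (ℚ.+-inverseʳ (𝒫₂ (𝒯 q) i j))

  𝒟Y≡0 : ∀ i j → 𝒟 Y i j ≡ 0ℚ
  𝒟Y≡0 = 𝒟²≡0⇒𝒟≡0 Y λ i j → trans (𝒟-cong 𝒟Y≡𝒯 i j) (𝒟𝒯≡0 (λ k → (- 1ℚ) * p k) i j)

  Y≡0 : ∀ i j → Y i j ≡ 0ℚ
  Y≡0 = antisymmetric∧commuting⇒0 Y (Alt-antisymmetric b) 𝒟Y≡0

  Z≡0 : ∀ i j → 𝒯 p i j ≡ 0ℚ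
  Z≡0 i j = trans (sym (ℚ.+-identityˡ (𝒯 p i j))) (trans (cong (_+ 𝒯 p i j) (sym (𝒟Y≡0 i j))) (S≡0 i j))

-- Vertices and adjacency matrices

∣⊖∣ : ∀ m n → ℤ.∣ m ⊖ n ∣ ≡ ∣ m - n ∣
∣⊖∣ zero    zero    = refl
∣⊖∣ zero    (suc n) = refl
∣⊖∣ (suc m) zero    = refl
∣⊖∣ (suc m) (suc n) = trans (cong ℤ.∣_∣ (ℤ.[1+m]⊖[1+n]≡m⊖n m n)) (∣⊖∣ m n)

twice-+ : ∀ x → twice (ℤ.+ x) ≡ ℤ.+ suc (2 ℕ.* x)
twice-+ x = begin
  ℤ.+ 2 ℤ.* ℤ.+ x ℤ.+ 1ℤ     ≡⟨ cong (ℤ._+ 1ℤ) (ℤ.pos-* 2 x) ⟨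
  ℤ.+ (2 ℕ.* x) ℤ.+ 1ℤ     ≡⟨ cong ℤ.+_ (ℕ.+-comm (2 ℕ.* x) 1) ⟩
  ℤ.+ suc (2 ℕ.* x)        ∎

twice-- : ∀ y → twice -[1+ y ] ≡ -[1+ 2 ℕ.* y ]
twice-- y = cong (λ k → 1 ⊖ suc k) (ℕ.+-suc y (y ℕ.+ 0))

-- The point (x + 1/2, -(y + 1/2)) has doubled ℓ¹-norm (2x + 1) + (2y + 1), so the diamond condition
-- becomes `x + y < m`.
double-diamond : ∀ x y → ℤ.∣ twice (ℤ.+ x) ∣ ℕ.+ ℤ.∣ twice -[1+ y ] ∣ ≡ 2 ℕ.* suc (x ℕ.+ y)
double-diamond x y = trans (cong₂ (λ a b → ℤ.∣ a ∣ ℕ.+ ℤ.∣ b ∣) (twice-+ x) (twice-- y))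
  (ℕ-Solver.solve 2 (λ x y → (conℕ 1 ⊕ conℕ 2 ⊗ x) ⊕ (conℕ 1 ⊕ conℕ 2 ⊗ y) ⊜ conℕ 2 ⊗ (conℕ 1 ⊕ (x ⊕ y))) refl x y)
  where open ℕ-Solver using () renaming (con to conℕ; _:+_ to _⊕_; _:*_ to _⊗_; _:=_ to _⊜_)

-- Membership in an induced subgraph is stored irrelevantly; the bounds serve only to refute cases
-- and as irrelevant arguments.
gridIndex : ∀ {n} a → .(1ℤ ℤ.≤ a × a ℤ.≤ ℤ.+ n) → Fin n
gridIndex (ℤ.+ zero)  p = ⊥-elim-irr (ℕ.1+n≰n (ℤ.drop‿+≤+ (proj₁ p)))
gridIndex (ℤ.+ suc k) p = fromℕ< (ℤ.drop‿+≤+ (proj₂ p))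
gridIndex -[1+ k ]  p = ⊥-elim-irr (ℤ.≤⇒≯ (proj₁ p) ℤ.-<+)

gridIndex-correct : ∀ {n} a .(p : 1ℤ ℤ.≤ a × a ℤ.≤ ℤ.+ n) → ℤ.+ suc (toℕ (gridIndex a p)) ≡ a
gridIndex-correct (ℤ.+ zero)  p = ⊥-elim-irr (ℕ.1+n≰n (ℤ.drop‿+≤+ (proj₁ p)))
gridIndex-correct (ℤ.+ suc k) p = cong (λ k → ℤ.+ suc k) (Fin.toℕ-fromℕ< (ℤ.drop‿+≤+ (proj₂ p)))
gridIndex-correct -[1+ k ]  p = ⊥-elim-irr (ℤ.≤⇒≯ (proj₁ p) ℤ.-<+)

inRange : ∀ {n} (i : Fin n) → 1ℤ ℤ.≤ ℤ.+ suc (toℕ i) × ℤ.+ suc (toℕ i) ℤ.≤ ℤ.+ n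
inRange i = ℤ.+≤+ (s≤s z≤n) , ℤ.+≤+ (Fin.toℕ<n i)

gridVertices : ∀ n → (Fin n × Fin n) ↔ Graph.Vertex (grid n)
gridVertices n = mk↔ₛ′
  (λ (i , j) → (ℤ.+ suc (toℕ i) , ℤ.+ suc (toℕ j)) , [ inRange i , inRange j ])
  (λ { ((a , b) , [ p ]) → gridIndex a (proj₁ p) , gridIndex b (proj₂ p) })
  (λ { ((a , b) , [ p ]) → value-injective (cong₂ _,_ (gridIndex-correct a (proj₁ p)) (gridIndex-correct b (proj₂ p))) })
  (λ (i , j) → cong₂ _,_ (Fin.fromℕ<-toℕ i (Fin.toℕ<n i)) (Fin.fromℕ<-toℕ j (Fin.toℕ<n j)))

-- (lo u , depth u) are the coordinates of u in the quartered Aztec diamond.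
depth : ∀ {n} → Tri n → ℕ
depth {suc n} (inj₁ j) = toℕ (opposite j)
depth {suc n} (inj₂ u) = depth u

toℕ+opposite : ∀ {n} (i : Fin n) → suc (toℕ i ℕ.+ toℕ (opposite i)) ≡ n
toℕ+opposite i = trans (cong (suc (toℕ i) ℕ.+_) (Fin.opposite-prop i)) (ℕ.m+[n∸m]≡n (Fin.toℕ<n i))

hi+depth : ∀ {n} (u : Tri n) → suc (toℕ (hi u) ℕ.+ depth u) ≡ n
hi+depth {suc n} (inj₁ j) = cong suc (toℕ+opposite j)
hi+depth {suc n} (inj₂ u) = cong suc (hi+depth u)

lo<hi : ∀ {n} (u : Tri n) → toℕ (lo u) < toℕ (hi u)
lo<hi {suc n} (inj₁ j) = s≤s z≤n
lo<hi {suc n} (inj₂ u) = s≤s (lo<hi u)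

lo+depth< : ∀ {m} (u : Tri (suc m)) → toℕ (lo u) ℕ.+ depth u < m
lo+depth< u = subst (toℕ (lo u) ℕ.+ depth u <_) (ℕ.suc-injective (hi+depth u)) (ℕ.+-monoˡ-< (depth u) (lo<hi u))

tri : ∀ m x y → .(x ℕ.+ y < m) → Tri (suc m)
-- Depth is counted from the far end of the row, hence `opposite`.
tri m       zero    y p = inj₁ (opposite (fromℕ< p))
tri (suc m) (suc x) y p = inj₂ (tri m x y (ℕ.s<s⁻¹ p))

lo-tri : ∀ m x y .(p : x ℕ.+ y < m) → toℕ (lo (tri m x y p)) ≡ x
lo-tri m       zero    y p = refl
lo-tri (suc m) (suc x) y p = cong suc (lo-tri m x y (ℕ.s<s⁻¹ p))

depth-tri : ∀ m x y .(p : x ℕ.+ y < m) → depth (tri m x y p) ≡ y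
depth-tri m       zero    y p = trans (cong toℕ (Fin.opposite-involutive (fromℕ< p))) (Fin.toℕ-fromℕ< p)
depth-tri (suc m) (suc x) y p = depth-tri m x y (ℕ.s<s⁻¹ p)

tri-lo-depth : ∀ m (u : Tri (suc m)) .(p : toℕ (lo u) ℕ.+ depth u < m) → tri m (toℕ (lo u)) (depth u) p ≡ u
tri-lo-depth m       (inj₁ j) p =
  cong inj₁ (trans (cong opposite (Fin.fromℕ<-toℕ (opposite j) p)) (Fin.opposite-involutive j))
tri-lo-depth (suc m) (inj₂ u) p = cong inj₂ (tri-lo-depth m u (ℕ.s<s⁻¹ p))

Southeast : ℕ → ℤ → ℤ → Set
Southeast m a b = ℤ.∣ twice a ∣ ℕ.+ ℤ.∣ twice b ∣ ≤ 2 ℕ.* m × (0ℤ ℤ.< twice a × twice b ℤ.< 0ℤ)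

southeast-+- : ∀ m x y → x ℕ.+ y < m → Southeast m (ℤ.+ x) -[1+ y ]
southeast-+- m x y x+y<m =
  subst (_≤ 2 ℕ.* m) (sym (double-diamond x y)) (ℕ.*-monoʳ-≤ 2 x+y<m) ,
  subst (0ℤ ℤ.<_) (sym (twice-+ x)) (ℤ.+<+ (s≤s z≤n)) ,
  subst (ℤ._< 0ℤ) (sym (twice-- y)) ℤ.-<+

southeast-bound : ∀ m x y → Southeast m (ℤ.+ x) -[1+ y ] → x ℕ.+ y < m
southeast-bound m x y (p , _) = ℕ.*-cancelˡ-≤ 2 (subst (_≤ 2 ℕ.* m) (double-diamond x y) p)

¬southeast-++ : ∀ m x y → Southeast m (ℤ.+ x) (ℤ.+ y) → ⊥
¬southeast-++ m x y (_ , _ , q) = ℤ.+≮0 (subst (ℤ._< 0ℤ) (twice-+ y) q)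

¬southeast-- : ∀ m x b → Southeast m -[1+ x ] b → ⊥
¬southeast-- m x b (_ , q , _) = ℤ.+≮- (subst (0ℤ ℤ.<_) (twice-- x) q)

triIndex : ∀ m a b → .(Southeast m a b) → Tri (suc m)
triIndex m (ℤ.+ x)    -[1+ y ] p = tri m x y (southeast-bound m x y p)
triIndex m (ℤ.+ x)    (ℤ.+ y)    p = ⊥-elim-irr (¬southeast-++ m x y p)
triIndex m -[1+ x ] b        p = ⊥-elim-irr (¬southeast-- m x b p)

-- Integer pairs stand for half-integer points, so the southeastern quarter consists of the pairs
-- with first entry at least 0 and second entry at most -1.
triPoint : ∀ {n} → Tri n → ℤ × ℤ
triPoint u = ℤ.+ toℕ (lo u) , -[1+ depth u ]

triIndex-correct : ∀ m a b .(p : Southeast m a b) → triPoint (triIndex m a b p) ≡ (a , b)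
triIndex-correct m (ℤ.+ x)    -[1+ y ] p = cong₂ (λ x y → ℤ.+ x , -[1+ y ])
  (lo-tri m x y (southeast-bound m x y p)) (depth-tri m x y (southeast-bound m x y p))
triIndex-correct m (ℤ.+ x)    (ℤ.+ y)    p = ⊥-elim-irr (¬southeast-++ m x y p)
triIndex-correct m -[1+ x ] b        p = ⊥-elim-irr (¬southeast-- m x b p)

qadVertices : ∀ m → Tri (suc m) ↔ Graph.Vertex (QAD m)
qadVertices m = mk↔ₛ′
  (λ u → (triPoint u , [ proj₁ (inside u) ]) , [ proj₂ (inside u) ])
  (λ { (((a , b) , [ p ]) , [ q ]) → triIndex m a b (p , q) })
  (λ { (((a , b) , [ p ]) , [ q ]) → value-injective (value-injective (triIndex-correct m a b (p , q))) })
  (λ u → tri-lo-depth m u (lo+depth< u))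
  where
  inside : ∀ u → Southeast m (ℤ.+ toℕ (lo u)) -[1+ depth u ]
  inside u = southeast-+- m (toℕ (lo u)) (depth u) (lo+depth< u)

adjacencyEntry-edge : ∀ G u v (e : Adj G u v) → adjacencyEntry G u v ≡ weight G u v e
adjacencyEntry-edge G u v e with WeightedGraph.adj? G u v
... | yes _ = refl
... | no ¬e = contradiction e ¬e

adjacencyEntry-nonedge : ∀ G u v → ¬ Adj G u v → adjacencyEntry G u v ≡ 0ℚ
adjacencyEntry-nonedge G u v ¬e with WeightedGraph.adj? G u v
... | yes e = contradiction e ¬e
... | no _  = refl

is1-≢1 : ∀ {d} → d ≢ 1 → is1 d ≡ 0ℚ
is1-≢1 {zero}        d≢1 = refl
is1-≢1 {suc zero}    d≢1 = contradiction refl d≢1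
is1-≢1 {suc (suc d)} d≢1 = refl

-- The number `d` need only detect adjacency, so the lattice distance can be replaced by a distance
-- in triangle or grid indices.
adjacencyEntry-constant : ∀ q G u v d → (Graph.Adj G u v → d ≡ 1) → (d ≡ 1 → Graph.Adj G u v) →
                          adjacencyEntry (constantWeight q G) u v ≡ q * is1 d
adjacencyEntry-constant q G u v d ⇒ ⇐ with d ℕ.≟ 1
... | yes refl = trans (adjacencyEntry-edge (constantWeight q G) u v (⇐ refl)) (sym (ℚ.*-identityʳ q))
... | no d≢1   = trans (adjacencyEntry-nonedge (constantWeight q G) u v (d≢1 ∘ ⇒))
                       (sym (trans (cong (q *_) (is1-≢1 d≢1)) (ℚ.*-zeroʳ q)))

module _ (G H : WeightedGraph) where

  adjacencyEntry-inj₁ : ∀ u v → adjacencyEntry (G ∪̇ H) (inj₁ u) (inj₁ v) ≡ adjacencyEntry G u v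
  adjacencyEntry-inj₁ u v = by-cases (WeightedGraph.adj? G u v)
    where
    by-cases : Dec (Adj G u v) → adjacencyEntry (G ∪̇ H) (inj₁ u) (inj₁ v) ≡ adjacencyEntry G u v
    by-cases (yes e) = trans (adjacencyEntry-edge (G ∪̇ H) (inj₁ u) (inj₁ v) (Pointwise.inj₁ e)) (sym (adjacencyEntry-edge G u v e))
    by-cases (no ¬e) = trans (adjacencyEntry-nonedge (G ∪̇ H) (inj₁ u) (inj₁ v) (¬e ∘ Pointwise.drop-inj₁)) (sym (adjacencyEntry-nonedge G u v ¬e))

  adjacencyEntry-inj₂ : ∀ u v → adjacencyEntry (G ∪̇ H) (inj₂ u) (inj₂ v) ≡ adjacencyEntry H u v
  adjacencyEntry-inj₂ u v = by-cases (WeightedGraph.adj? H u v)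
    where
    by-cases : Dec (Adj H u v) → adjacencyEntry (G ∪̇ H) (inj₂ u) (inj₂ v) ≡ adjacencyEntry H u v
    by-cases (yes e) = trans (adjacencyEntry-edge (G ∪̇ H) (inj₂ u) (inj₂ v) (Pointwise.inj₂ e)) (sym (adjacencyEntry-edge H u v e))
    by-cases (no ¬e) = trans (adjacencyEntry-nonedge (G ∪̇ H) (inj₂ u) (inj₂ v) (¬e ∘ Pointwise.drop-inj₂)) (sym (adjacencyEntry-nonedge H u v ¬e))

grid-adjacency : ∀ {n} (i j k l : Fin n) →
  adjacencyEntry (unweighted (grid n)) (to (gridVertices n) (i , j)) (to (gridVertices n) (k , l)) ≡
  1ℚ * is1 (distance i k ℕ.+ distance j l)
grid-adjacency {n} i j k l = adjacencyEntry-constant 1ℚ (grid n) (to (gridVertices n) (i , j)) (to (gridVertices n) (k , l)) (distance i k ℕ.+ distance j l)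
  (trans (sym eq)) (trans eq)
  where
  eq : ℤ.∣ suc (toℕ i) ⊖ suc (toℕ k) ∣ ℕ.+ ℤ.∣ suc (toℕ j) ⊖ suc (toℕ l) ∣ ≡ distance i k ℕ.+ distance j l
  eq = cong₂ ℕ._+_ (∣⊖∣ (suc (toℕ i)) (suc (toℕ k))) (∣⊖∣ (suc (toℕ j)) (suc (toℕ l)))

complement-distance : ∀ a b c d → a ℕ.+ b ≡ c ℕ.+ d → ∣ d - b ∣ ≡ ∣ a - c ∣
complement-distance a b c d eq = begin
  ∣ d - b ∣                    ≡⟨ ℕ.∣m+n-m+o∣≡∣n-o∣ c d b ⟨
  ∣ c ℕ.+ d - c ℕ.+ b ∣        ≡⟨ cong (λ s → ∣ s - c ℕ.+ b ∣) eq ⟨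
  ∣ a ℕ.+ b - c ℕ.+ b ∣        ≡⟨ cong₂ ∣_-_∣ (ℕ.+-comm a b) (ℕ.+-comm c b) ⟩
  ∣ b ℕ.+ a - b ℕ.+ c ∣        ≡⟨ ℕ.∣m+n-m+o∣≡∣n-o∣ b a c ⟩
  ∣ a - c ∣                    ∎

-- Since `hi` and `depth` have constant sum, differences of depth have the same absolute value as
-- differences of `hi`.
qad-adjacency : ∀ {m} (u v : Tri (suc m)) →
  adjacencyEntry (unweighted (QAD m)) (to (qadVertices m) u) (to (qadVertices m) v) ≡ 1ℚ * is1 (triDistance u v)
qad-adjacency {m} u v = adjacencyEntry-constant 1ℚ (QAD m) (to (qadVertices m) u) (to (qadVertices m) v) (triDistance u v) (trans (sym eq)) (trans eq)
  where
  eq : ℤ.∣ ℤ.+ toℕ (lo u) ℤ.- ℤ.+ toℕ (lo v) ∣ ℕ.+ ℤ.∣ suc (depth v) ⊖ suc (depth u) ∣ ≡ triDistance u v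
  eq = cong₂ ℕ._+_
    (trans (cong ℤ.∣_∣ (ℤ.m-n≡m⊖n (toℕ (lo u)) (toℕ (lo v)))) (∣⊖∣ (toℕ (lo u)) (toℕ (lo v))))
    (trans (∣⊖∣ (suc (depth v)) (suc (depth u)))
      (complement-distance (toℕ (hi u)) (depth u) (toℕ (hi v)) (depth v) (ℕ.suc-injective (trans (hi+depth u) (sym (hi+depth v))))))

path-adjacency : ∀ {n} (i k : Fin n) → adjacencyEntry (P⁽²⁾ n) i k ≡ 2ℚ * is1 (distance i k)
path-adjacency {n} i k = adjacencyEntry-constant 2ℚ (path n) i k (distance i k) (λ e → e) (λ e → e)

-- Counting the vertices and summing over them

sum-splitAt : ∀ m {n} (F : Fin m ⊎ Fin n → ℚ) → sum (F ∘ splitAt m) ≡ sum (F ∘ inj₁) + sum (F ∘ inj₂)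
sum-splitAt zero    F = sym (ℚ.+-identityˡ (sum (F ∘ inj₂)))
sum-splitAt (suc m) F = trans (cong (λ s → F (inj₁ zero) + s) (sum-splitAt m (F ∘ map₁ suc)))
  (sym (ℚ.+-assoc (F (inj₁ zero)) (sum λ i → F (inj₁ (suc i))) (sum λ j → F (inj₂ j))))

sum-remQuot : ∀ m {n} (F : Fin m × Fin n → ℚ) → sum (F ∘ remQuot {m} n) ≡ sum λ i → sum λ j → F (i , j)
sum-remQuot zero    {n} F = refl
sum-remQuot (suc m) {n} F = trans (sum-splitAt n G)
  (cong (λ s → sum (λ j → F (zero , j)) + s) (sum-remQuot m (λ (i , j) → F (suc i , j))))
  where
  G : Fin n ⊎ Fin (m ℕ.* n) → ℚ
  -- One unfolding of `remQuot`, as a function of the result of `splitAt`.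
  G s = F (swap ([ (λ j → j , zero) , map₂ suc ∘ quotRem {m} n ]′ s))

triangular : ℕ → ℕ
triangular zero    = 0
triangular (suc n) = n ℕ.+ triangular n

partsCount : ℕ → ℕ
partsCount n = triangular n ℕ.+ (triangular n ℕ.+ n)

-- The dimension count that makes the injective intertwiner square.
partsCount≡n*n : ∀ n → partsCount n ≡ n ℕ.* n
partsCount≡n*n zero    = refl
partsCount≡n*n (suc n) = begin
  (n ℕ.+ t) ℕ.+ ((n ℕ.+ t) ℕ.+ suc n)
    ≡⟨ ℕ-Solver.solve 2 (λ n t → (n ⊕ t) ⊕ ((n ⊕ t) ⊕ (conℕ 1 ⊕ n)) ⊜ conℕ 1 ⊕ (n ⊕ (n ⊕ (t ⊕ (t ⊕ n))))) refl n t ⟩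
  suc (n ℕ.+ (n ℕ.+ partsCount n))
    ≡⟨ cong (λ k → suc (n ℕ.+ (n ℕ.+ k))) (partsCount≡n*n n) ⟩
  suc (n ℕ.+ (n ℕ.+ n ℕ.* n))
    ≡⟨ cong (λ k → suc (n ℕ.+ k)) (ℕ.*-suc n n) ⟨
  suc n ℕ.* suc n ∎
  where
  t = triangular n
  open ℕ-Solver using () renaming (con to conℕ; _:+_ to _⊕_; _:=_ to _⊜_)

-- A numbering bundled with the rule that sums along it equal the structured sum `Σ`; thus matrix
-- products over `Fin N` become nested sums over the vertices.
Enumeration : (I : Set) → ((I → ℚ) → ℚ) → ℕ → Set
Enumeration I Σ N = Σ[ e ∈ Fin N ↔ I ] ∀ F → sum (F ∘ to e) ≡ Σ F

enumerate-⊎ : ∀ {I J Σ Σ′ M N} → Enumeration I Σ M → Enumeration J Σ′ N →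
              Enumeration (I ⊎ J) (λ F → Σ (F ∘ inj₁) + Σ′ (F ∘ inj₂)) (M ℕ.+ N)
enumerate-⊎ {M = M} (e , Σ-e) (f , Σ-f) = (e ⊎-↔ f) ↔-∘ Fin.+↔⊎ , λ F →
  trans (sum-splitAt M (F ∘ to (e ⊎-↔ f))) (cong₂ _+_ (Σ-e (λ i → F (inj₁ i))) (Σ-f (λ j → F (inj₂ j))))

enumerate-Fin : ∀ n → Enumeration (Fin n) sum n
enumerate-Fin n = ↔-id (Fin n) , λ F → refl

enumerate-Tri : ∀ n → Enumeration (Tri n) sumTri (triangular n)
enumerate-Tri zero    = Fin.0↔⊥ , λ F → refl
enumerate-Tri (suc n) = enumerate-⊎ (enumerate-Fin n) (enumerate-Tri n)

sumParts : ∀ {n} → (Parts n → ℚ) → ℚ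
sumParts F = sumTri (λ u → F (inj₁ u)) + (sumTri (λ u → F (inj₂ (inj₁ u))) + sum (λ i → F (inj₂ (inj₂ i))))

enumerate-Parts : ∀ n → Enumeration (Parts n) sumParts (partsCount n)
enumerate-Parts n = enumerate-⊎ (enumerate-Tri n) (enumerate-⊎ (enumerate-Tri n) (enumerate-Fin n))

sumPairs : ∀ {n} → (Fin n × Fin n → ℚ) → ℚ
sumPairs F = sum λ i → sum λ j → F (i , j)

enumerate-Pairs : ∀ n → Enumeration (Fin n × Fin n) sumPairs (partsCount n)
-- Both graphs must be numbered by the same `Fin N` for their matrices to be comparable.
enumerate-Pairs n = subst (Enumeration (Fin n × Fin n) sumPairs) (sym (partsCount≡n*n n))
  (Fin.*↔× , sum-remQuot n)

sumTri-zero : ∀ {n} {f : Tri n → ℚ} → (∀ u → f u ≡ 0ℚ) → sumTri f ≡ 0ℚ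
sumTri-zero {zero}  f≡0 = refl
sumTri-zero {suc n} f≡0 = cong₂ _+_ (sum-zero λ j → f≡0 (inj₁ j)) (sumTri-zero λ u → f≡0 (inj₂ u))

partsGraph : ℕ → WeightedGraph
partsGraph m = unweighted (QAD m) ∪̇ unweighted (QAD m) ∪̇ P⁽²⁾ (suc m)

partsVertices : ∀ m → Parts (suc m) ↔ WeightedGraph.Vertex (partsGraph m)
partsVertices m = qadVertices m ⊎-↔ qadVertices m ⊎-↔ ↔-id (Fin (suc m))

sumPairs-adjacency : ∀ n (X : Grid n) w →
  sumPairs (λ v → adjacencyEntry (unweighted (grid n)) (to (gridVertices n) w) (to (gridVertices n) v) * X (proj₁ v) (proj₂ v)) ≡
  𝒜 X (proj₁ w) (proj₂ w)
sumPairs-adjacency n X (i , j) = trans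
  (sum-cong-≗ {n} λ k → sum-cong-≗ {n} λ l → cong (_* X k l)
    (trans (grid-adjacency i j k l) (ℚ.*-identityˡ (is1 (distance i k ℕ.+ distance j l)))))
  (𝒜-adjacency X i j)

module _ (m : ℕ) where

  private
    n = suc m
    Q = unweighted (QAD m)
    R = P⁽²⁾ n
    φ = to (qadVertices m)
    ω = to (partsVertices m)

  qad-term : ∀ (b : Tri n → ℚ) u v →
    adjacencyEntry Q (to (qadVertices m) u) (to (qadVertices m) v) * b v ≡ is1 (triDistance u v) * b v
  qad-term b u v = cong (_* b v) (trans (qad-adjacency u v) (ℚ.*-identityˡ (is1 (triDistance u v))))

  nonedge-term : ∀ (F : Parts n → ℚ) w v → ¬ Adj (partsGraph m) (ω w) (ω v) →
                 adjacencyEntry (partsGraph m) (ω w) (ω v) * F v ≡ 0ℚ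
  nonedge-term F w v ¬e =
    trans (cong (_* F v) (adjacencyEntry-nonedge (partsGraph m) (ω w) (ω v) ¬e)) (ℚ.*-zeroˡ (F v))

  -- The adjacency matrix of a disjoint union is block diagonal, so only one of the three sums
  -- survives.
  sumParts-adjacency : ∀ (F : Parts n → ℚ) w →
    sumParts (λ v → adjacencyEntry (partsGraph m) (ω w) (ω v) * F v) ≡ ℬ F w
  sumParts-adjacency F (inj₁ u) = trans
    (cong₂ _+_
      (sumTri-cong λ v → trans
        (cong (_* F (inj₁ v)) (adjacencyEntry-inj₁ Q (Q ∪̇ R) (φ u) (φ v)))
        (qad-term (λ u → F (inj₁ u)) u v))
      (cong₂ _+_ (sumTri-zero λ v → nonedge-term F w (inj₂ (inj₁ v)) λ ())
                 (sum-zero {n} λ i → nonedge-term F w (inj₂ (inj₂ i)) λ ())))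
    (ℚ.+-identityʳ (ℬ F w))
    where
    w : Parts n
    w = inj₁ u
  sumParts-adjacency F (inj₂ (inj₁ u)) = trans
    (cong₂ _+_
      (sumTri-zero λ v → nonedge-term F w (inj₁ v) λ ())
      (cong₂ _+_
        (sumTri-cong λ v → trans
          (cong (_* F (inj₂ (inj₁ v))) (trans
            (adjacencyEntry-inj₂ Q (Q ∪̇ R) (inj₁ (φ u)) (inj₁ (φ v)))
            (adjacencyEntry-inj₁ Q R (φ u) (φ v))))
          (qad-term (λ u → F (inj₂ (inj₁ u))) u v))
        (sum-zero {n} λ i → nonedge-term F w (inj₂ (inj₂ i)) λ { (Pointwise.inj₂ ()) })))
    (trans (ℚ.+-identityˡ (ℬ F w + 0ℚ)) (ℚ.+-identityʳ (ℬ F w)))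
    where
    w : Parts n
    w = inj₂ (inj₁ u)
  sumParts-adjacency F (inj₂ (inj₂ i)) = trans
    (cong₂ _+_
      (sumTri-zero λ v → nonedge-term F w (inj₁ v) λ ())
      (cong₂ _+_
        (sumTri-zero λ v → nonedge-term F w (inj₂ (inj₁ v)) λ { (Pointwise.inj₂ ()) })
        (begin
          sum (λ k → adjacencyEntry (partsGraph m) (inj₂ (inj₂ i)) (inj₂ (inj₂ k)) * p k)
            ≡⟨ sum-cong-≗ {n} (λ k → trans
                 (cong (_* p k) (trans (adjacencyEntry-inj₂ Q (Q ∪̇ R) (inj₂ i) (inj₂ k))
                   (trans (adjacencyEntry-inj₂ Q R i k) (path-adjacency i k))))
                 (ℚ.*-assoc 2ℚ (is1 (distance i k)) (p k))) ⟩
          sum (λ k → 2ℚ * (is1 (distance i k) * p k))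
            ≡⟨ *-distribˡ-sum 2ℚ (λ k → is1 (distance i k) * p k) ⟨
          2ℚ * 𝒫 p i ∎)))
    (trans (ℚ.+-identityˡ (0ℚ + ℬ F w)) (ℚ.+-identityˡ (ℬ F w)))
    where
    w : Parts n
    w = inj₂ (inj₂ i)
    p : Fin n → ℚ
    p k = F (inj₂ (inj₂ k))

theorem2p1 : (n : ℕ) → 1 ≤ n →
    unweighted (grid n) ∼ unweighted (QAD (n ∸ 1)) ∪̇ unweighted (QAD (n ∸ 1)) ∪̇ P⁽²⁾ n
theorem2p1 n@(suc m) _ = partsCount n , γ ↔-∘ ε , ω ↔-∘ η ,
  intertwiner⇒similar T T-linear T-injective intertwines
  where
  γ = gridVertices n
  ω = partsVertices m
  ε = proj₁ (enumerate-Pairs n)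
  η = proj₁ (enumerate-Parts n)

  A B : Matrix (partsCount n)
  A = adjacencyMatrix (unweighted (grid n)) (γ ↔-∘ ε)
  B = adjacencyMatrix (partsGraph m) (ω ↔-∘ η)

  T : (Fin (partsCount n) → ℚ) → Fin (partsCount n) → ℚ
  T x r = ℳ (x ∘ from η) (proj₁ (to ε r)) (proj₂ (to ε r))

  T-linear : ∀ r → Linear (λ x → T x r)
  T-linear r = precompose-linear (from η) (ℳ-linear (proj₁ (to ε r)) (proj₂ (to ε r)))

  T-injective : ∀ x → (∀ r → T x r ≡ 0ℚ) → ∀ r → x r ≡ 0ℚ
  T-injective x Tx≡0 r = trans (cong x (sym (strictlyInverseʳ η r)))
    (ℳ-injective (x ∘ from η) (λ i j → subst (λ v → ℳ (x ∘ from η) (proj₁ v) (proj₂ v) ≡ 0ℚ)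
      (strictlyInverseˡ ε (i , j)) (Tx≡0 (from ε (i , j)))) (to η r))

  B·x : ∀ x w → (B · x) (from η w) ≡ ℬ (x ∘ from η) w
  B·x x w = begin
    sum (λ k → adjacencyEntry (partsGraph m) (to ω (to η (from η w))) (to ω (to η k)) * x k)
      -- Rewriting `x k` at `from η (to η k)` makes the summand a function of the vertex `to η k`,
      -- as the enumeration requires.
      ≡⟨ sum-cong-≗ {partsCount n} (λ k → cong₂ (λ w r → adjacencyEntry (partsGraph m) (to ω w) (to ω (to η k)) * x r)
           (strictlyInverseˡ η w) (sym (strictlyInverseʳ η k))) ⟩
    sum (λ k → adjacencyEntry (partsGraph m) (to ω w) (to ω (to η k)) * x (from η (to η k)))
      ≡⟨ proj₂ (enumerate-Parts n) (λ v → adjacencyEntry (partsGraph m) (to ω w) (to ω v) * x (from η v)) ⟩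
    sumParts (λ v → adjacencyEntry (partsGraph m) (to ω w) (to ω v) * x (from η v))
      ≡⟨ sumParts-adjacency m (x ∘ from η) w ⟩
    ℬ (x ∘ from η) w ∎

  intertwines : ∀ x → A · T x ≗ T (B · x)
  intertwines x r = begin
    (A · T x) r
      ≡⟨ proj₂ (enumerate-Pairs n) (λ v → adjacencyEntry (unweighted (grid n)) (to γ (to ε r)) (to γ v) *
           ℳ (x ∘ from η) (proj₁ v) (proj₂ v)) ⟩
    sumPairs (λ v → adjacencyEntry (unweighted (grid n)) (to γ (to ε r)) (to γ v) * ℳ (x ∘ from η) (proj₁ v) (proj₂ v))
      ≡⟨ sumPairs-adjacency n (ℳ (x ∘ from η)) (to ε r) ⟩
    𝒜 (ℳ (x ∘ from η)) i j
      ≡⟨ 𝒜-ℳ (x ∘ from η) i j ⟩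
    ℳ (ℬ (x ∘ from η)) i j
      ≡⟨ Linear.cong-≗ (ℳ-linear i j) (B·x x) ⟨
    T (B · x) r ∎
    where
    i = proj₁ (to ε r)
    j = proj₂ (to ε r)
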